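{- For $n\ge 1$ and integers $i,j$, let $\underline{b}_{n,i,j}$ be the number of $\pi\in\mathfrak{B}_n$ with $\operatorname{des}_B(\pi)=i$ and $\operatorname{ides}_B(\pi)=j$ (so $\underline{b}_{n,i,j}=0$ if $i<0$ or $j<0$). Then $\underline{b}_{1,0,0}=\underline{b}_{1,1,1}=1$, $\underline{b}_{1,0,1}=\underline{b}_{1,1,0}=0$, and for all $n\ge 2$ and $0\le i,j\le n$, \[ \begin{aligned} n\,\underline{b}_{n,i,j}={}&(n+i+j+2ij)\,\underline{b}_{n-1,i,j}+\big((2n-1)i-(2i+1)(j-1)\big)\,\underline{b}_{n-1,i,j-1}\\ &+\big((2n-1)j-(2j+1)(i-1)\big)\,\underline{b}_{n-1,i-1,j}\\ &+\big((2n^2-n)+2(i-1)(j-1)+(1-2n)(i+j-2)\big)\,\underline{b}_{n-1,i-1,j-1}. \end{aligned} \]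
   Context: For a positive integer $n$, $\mathfrak{B}_n$ is the set of signed permutations of length $n$: words $\pi=\pi_1\cdots\pi_n$ with $\pi_i\in\{\pm1,\dots,\pm n\}$ such that $|\pi_1|,\dots,|\pi_n|$ is a permutation of $[n]$. Set $\pi_0=0$. The inverse $\pi^{ -1}\in\mathfrak{B}_n$ is defined by $\pi^{ -1}_{|\pi_i|}=\operatorname{sgn}(\pi_i)\,i$. The $r$-order on $\mathbb{Z}$ is the total order $-1<_r-2<_r-3<_r\cdots<_r0<_r1<_r2<_r\cdots$ (all negatives below $0$ and the positives, with $-a<_r-b$ iff $a<b$; nonnegatives in natural order). Define $\operatorname{des}_B(\pi)=|\{i\in\{0,\dots,n-1\}:\pi_i>_r\pi_{i+1}\}|$ and $\operatorname{ides}_B(\pi)=\operatorname{des}_B(\pi^{ -1})$. -}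

module Defs where

open import Data.Nat using (ℕ; zero; suc)
open import Data.Integer using (ℤ; +_; -[1+_]; -_; ∣_∣)
open import Data.Bool using (Bool; true; false; if_then_else_)
open import Data.List using (List; []; _∷_; map; concatMap; filter; length; upTo; all)
open import Data.List.Relation.Unary.All using (All)
open import Data.List.Relation.Unary.Any using (Any)
open import Data.List.Relation.Unary.All.Properties using ()
open import Relation.Nullary.Decidable using (⌊_⌋; does; Dec; _×-dec_)
open import Relation.Binary.PropositionalEquality using (_≡_)
import Data.Nat as ℕ
import Data.Integer as ℤ
import Data.List.Relation.Unary.Any as Any
import Data.List.Relation.Unary.All as All

oneTo : ℕ → List ℕ
oneTo n = map suc (upTo n)

letters : ℕ → List ℤ
letters n = concatMap (λ k → (+ k) ∷ (- (+ k)) ∷ []) (oneTo n)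

words : ℕ → ℕ → List (List ℤ)
words n zero    = [] ∷ []
words n (suc m) = concatMap (λ w → map (_∷ w) (letters n)) (words n m)

-- A word π of length n over {±1,...,±n} is a signed permutation iff
-- |π_1|, ..., |π_n| is a permutation of [n], i.e. every k ∈ [n] occurs
-- among the |π_i| (n values in [n] covering [n]).
isSignedPerm : ℕ → List ℤ → Set
isSignedPerm n π = All (λ k → Any (λ x → ∣ x ∣ ≡ k) π) (oneTo n)

isSignedPerm? : (n : ℕ) → (π : List ℤ) → Dec (isSignedPerm n π)
isSignedPerm? n π = All.all? (λ k → Any.any? (λ x → ∣ x ∣ ℕ.≟ k) π) (oneTo n)

signedPerms : ℕ → List (List ℤ)
signedPerms n = filter (isSignedPerm? n) (words n n)

-- The inverse: π⁻¹_{|π_i|} = sgn(π_i) · i.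
invAux : ℕ → ℕ → List ℤ → ℤ
invAux k idx []       = + 0
invAux k idx (x ∷ xs) =
  if ⌊ ∣ x ∣ ℕ.≟ k ⌋
  then (if ⌊ x ℤ.<? + 0 ⌋ then - (+ idx) else + idx)
  else invAux k (suc idx) xs

inverse : ℕ → List ℤ → List ℤ
inverse n π = map (λ k → invAux k 1 π) (oneTo n)

-- The r-order:  -1 <_r -2 <_r -3 <_r ... <_r 0 <_r 1 <_r 2 <_r ...
-- gtR x y  is  true  iff  x >_r y.
gtR : ℤ → ℤ → Bool
gtR (+ a)      (+ b)      = ⌊ b ℕ.<? a ⌋
gtR (+ a)      -[1+ b ]   = true
gtR -[1+ a ]   (+ b)      = false
gtR -[1+ a ]   -[1+ b ]   = ⌊ b ℕ.<? a ⌋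

descentsFrom : ℤ → List ℤ → ℕ
descentsFrom p []       = 0
descentsFrom p (x ∷ xs) = (if gtR p x then 1 else 0) ℕ.+ descentsFrom x xs

-- des_B(π) = |{ i ∈ {0..n-1} : π_i >_r π_{i+1} }| with π_0 = 0
desB : List ℤ → ℕ
desB π = descentsFrom (+ 0) π

idesB : ℕ → List ℤ → ℕ
idesB n π = desB (inverse n π)

-- b̲_{n,i,j} = #{ π ∈ 𝔅_n : des_B(π) = i, ides_B(π) = j }  (i, j ∈ ℤ;
-- automatically 0 when i < 0 or j < 0)
bnij : ℕ → ℤ → ℤ → ℕ
bnij n i j = length (filter (λ π → (+ desB π) ℤ.≟ i ×-dec (+ idesB n π) ℤ.≟ j) (signedPerms n))

{-# OPTIONS --safe #-}
-- Fix p < n. Every π ∈ 𝔅ₙ arises exactly once by inserting a letter v = ±(q + 1) after the p-th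
-- letter of some σ ∈ 𝔅ₙ₋₁ whose absolute values above q have been raised by one; the inverse of π
-- then arises from σ⁻¹ by inserting ±(p + 1) after its q-th letter. With f the word 0 σ₁ … σₙ₋₁ n,
--   desB π = desB σ + 1 − X,  X = [f p > f (p + 1)] + [v > f p] − [v > f (p + 1)] ∈ {0, 1}
-- in the r-order (the final n acts as +∞), and idesB π = idesB σ + 1 − Y likewise with g the word
-- 0 σ⁻¹₁ … σ⁻¹ₙ₋₁ n. Summed over all (p, q, sign), with d = desB σ and e = idesB σ, telescoping gives
-- Σ X = n (2d + 1), Σ Y = n (2e + 1) and Σ X Y = n + d + e + 2de: for the product of the two telescoping parts, an Abel
-- summation over q evaluates the row p by g ∘ f, leaving 1 + [f p < 0] − [f (p + 1) < 0].
-- So the numbers of insertions that raise neither, one or both of the statistics depend on d and e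
-- only, and counting the pairs (π, p) in two ways is the recurrence.
module Submission where

open import Defs
open import Data.Bool using (Bool; true; false; if_then_else_; not; _∧_)
open import Data.Integer using (ℤ; +_; -[1+_]; _+_; _-_; _*_; ∣_∣; _◃_; sign)
open import Data.Integer.Tactic.RingSolver using (solve-∀)
open import Data.List using (List; []; _∷_; _++_; map; concatMap; filter; length; upTo; applyUpTo;
  cartesianProduct)
open import Data.List.Properties using (map-upTo; map-applyUpTo; map-∘; length-map; length-upTo;
  length-applyUpTo)
open import Data.List.Membership.Propositional using (_∈_)
open import Data.List.Membership.Propositional.Properties using (∈-∃++; ∈-upTo⁺; ∈-upTo⁻; ∈-map⁺; ∈-map⁻)
open import Data.List.Relation.Unary.All as All using (All; []; _∷_)
open import Data.List.Relation.Unary.AllPairs using ([]; _∷_)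
open import Data.List.Relation.Unary.Any as Any using (Any; here; there)
open import Data.List.Relation.Unary.Unique.Propositional using (Unique)
open import Data.List.Relation.Binary.Permutation.Propositional
  using (_↭_; prep; swap; ↭-refl; ↭-trans; ↭-sym; ↭⇒↭ₛ)
open import Data.List.Relation.Binary.Permutation.Propositional.Properties
  using (Any-resp-↭; ∈-resp-↭; ↭-length; map⁺; shift)
open import Data.Nat using (ℕ; zero; suc; _≤_; _<_; _<ᵇ_; _∸_; z≤n; s≤s)
open import Data.Product using (_×_; _,_; ∃)
open import Data.Sign using (Sign)
open import Data.Sum using (_⊎_; inj₁; inj₂)
open import Function using (_∘_; id; mk⇔)
open import Relation.Nullary using (¬_; does; yes; no; contradiction)
open import Relation.Nullary.Decidable using (⌊_⌋; isYes≗does; dec-true; dec-false; does-⇔; _×-dec_)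
open import Relation.Unary using (Decidable)
open import Relation.Binary.PropositionalEquality
import Data.Integer as ℤ
import Data.Integer.Properties as ℤ
import Data.List.Relation.Unary.All.Properties as All
import Data.List.Relation.Unary.Any.Properties as Any
import Data.List.Relation.Unary.Unique.Propositional.Properties as Unique
import Data.List.Relation.Binary.Permutation.Setoid.Properties as Permutationₛ
import Data.Nat as ℕ
import Data.Nat.Properties as ℕ
open ≡-Reasoning

private variable
  A B : Set

-- Sums over lists

∑ : {A : Set} → List A → (A → ℤ) → ℤ
∑ []       f = + 0
∑ (x ∷ xs) f = f x + ∑ xs f

syntax ∑ xs (λ x → e) = ∑[ x ∈ xs ] e

infixr 5 ∑

⟦_⟧ : Bool → ℤ
⟦ b ⟧ = if b then + 1 else + 0

+-congʳ : ∀ a {b c} → b ≡ c → a + b ≡ a + c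
+-congʳ a = cong (λ z → a + z)

∑-cong-All : ∀ {xs : List A} {f g} → All (λ x → f x ≡ g x) xs → ∑ xs f ≡ ∑ xs g
∑-cong-All []         = refl
∑-cong-All (px ∷ pxs) = cong₂ _+_ px (∑-cong-All pxs)

∑-cong : ∀ (xs : List A) {f g} → (∀ x → f x ≡ g x) → ∑ xs f ≡ ∑ xs g
∑-cong xs f≗g = ∑-cong-All (All.universal f≗g xs)

∑-cong-< : ∀ n {f g : ℕ → ℤ} → (∀ k → k < n → f k ≡ g k) → ∑ (upTo n) f ≡ ∑ (upTo n) g
∑-cong-< n f≗g = ∑-cong-All (All.map (f≗g _) (All.all-upTo n))

∑-+ : ∀ (xs : List A) f g → (∑[ x ∈ xs ] f x + g x) ≡ ∑ xs f + ∑ xs g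
∑-+ []       f g = refl
∑-+ (x ∷ xs) f g = trans (+-congʳ (f x + g x) (∑-+ xs f g)) (interchange (f x) (g x) _ _)
  where
  interchange : ∀ a b c d → (a + b) + (c + d) ≡ (a + c) + (b + d)
  interchange = solve-∀

∑-*ˡ : ∀ (xs : List A) c f → (∑[ x ∈ xs ] c * f x) ≡ c * ∑ xs f
∑-*ˡ []       c f = sym (ℤ.*-zeroʳ c)
∑-*ˡ (x ∷ xs) c f = trans (+-congʳ (c * f x) (∑-*ˡ xs c f)) (factor c (f x) _)
  where
  factor : ∀ c a b → c * a + c * b ≡ c * (a + b)
  factor = solve-∀

∑-*ʳ : ∀ (xs : List A) f c → (∑[ x ∈ xs ] f x * c) ≡ ∑ xs f * c
∑-*ʳ []       f c = refl
∑-*ʳ (x ∷ xs) f c = trans (+-congʳ (f x * c) (∑-*ʳ xs f c)) (factor c (f x) _)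
  where
  factor : ∀ c a b → a * c + b * c ≡ (a + b) * c
  factor = solve-∀

∑-zero : ∀ (xs : List A) → (∑[ _ ∈ xs ] + 0) ≡ + 0
∑-zero []       = refl
∑-zero (x ∷ xs) = trans (ℤ.+-identityˡ _) (∑-zero xs)

∑-swap : ∀ (xs : List A) (ys : List B) (f : A → B → ℤ) →
  (∑[ x ∈ xs ] ∑[ y ∈ ys ] f x y) ≡ (∑[ y ∈ ys ] ∑[ x ∈ xs ] f x y)
∑-swap []       ys f = sym (∑-zero ys)
∑-swap (x ∷ xs) ys f = trans (+-congʳ (∑ ys (f x)) (∑-swap xs ys f)) (sym (∑-+ ys (f x) _))

∑-const : ∀ (xs : List A) c → (∑[ _ ∈ xs ] c) ≡ + length xs * c
∑-const []       c = refl
∑-const (x ∷ xs) c = trans (+-congʳ c (∑-const xs c)) (factor c (+ length xs))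
  where
  factor : ∀ c l → c + l * c ≡ (+ 1 + l) * c
  factor = solve-∀

∑-++ : ∀ (xs ys : List A) f → ∑ (xs ++ ys) f ≡ ∑ xs f + ∑ ys f
∑-++ []       ys f = sym (ℤ.+-identityˡ _)
∑-++ (x ∷ xs) ys f = trans (+-congʳ (f x) (∑-++ xs ys f)) (assoc (f x) _ _)
  where
  assoc : ∀ a b c → a + (b + c) ≡ (a + b) + c
  assoc = solve-∀

∑-map : ∀ (h : A → B) xs f → ∑ (map h xs) f ≡ ∑ xs (f ∘ h)
∑-map h []       f = refl
∑-map h (x ∷ xs) f = +-congʳ (f (h x)) (∑-map h xs f)

∑-concatMap : ∀ (h : A → List B) xs f → ∑ (concatMap h xs) f ≡ (∑[ x ∈ xs ] ∑ (h x) f)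
∑-concatMap h []       f = refl
∑-concatMap h (x ∷ xs) f = trans (∑-++ (h x) _ f) (+-congʳ (∑ (h x) f) (∑-concatMap h xs f))

∑-cartesianProduct : ∀ (xs : List A) (ys : List B) f →
  ∑ (cartesianProduct xs ys) f ≡ (∑[ x ∈ xs ] ∑[ y ∈ ys ] f (x , y))
∑-cartesianProduct []       ys f = refl
∑-cartesianProduct (x ∷ xs) ys f =
  trans (∑-++ (map (x ,_) ys) _ f) (cong₂ _+_ (∑-map (x ,_) ys f) (∑-cartesianProduct xs ys f))

∑-filter : ∀ {P : A → Set} (P? : Decidable P) xs f →
  ∑ (filter P? xs) f ≡ (∑[ x ∈ xs ] ⟦ does (P? x) ⟧ * f x)
∑-filter P? []       f = refl
∑-filter P? (x ∷ xs) f with does (P? x)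
... | true  = cong₂ _+_ (sym (ℤ.*-identityˡ (f x))) (∑-filter P? xs f)
... | false = trans (∑-filter P? xs f) (sym (ℤ.+-identityˡ _))

∑-applyUpTo : ∀ (h : ℕ → A) n f → ∑ (applyUpTo h n) f ≡ ∑ (upTo n) (f ∘ h)
∑-applyUpTo h n f = trans (cong (λ xs → ∑ xs f) (sym (map-upTo h n))) (∑-map h (upTo n) f)

∑-upTo-suc : ∀ n f → ∑ (upTo (suc n)) f ≡ f 0 + ∑ (upTo n) (f ∘ suc)
∑-upTo-suc n f = +-congʳ (f 0) (∑-applyUpTo suc n f)

∑-upTo-const : ∀ n c → (∑[ _ ∈ upTo n ] c) ≡ + n * c
∑-upTo-const n c = trans (∑-const (upTo n) c) (cong (λ l → + l * c) (length-upTo n))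

∑-telescope : ∀ n (h : ℕ → ℤ) → (∑[ k ∈ upTo n ] h k - h (suc k)) ≡ h 0 - h n
∑-telescope zero    h = cancel (h 0)
  where
  cancel : ∀ a → + 0 ≡ a - a
  cancel = solve-∀
∑-telescope (suc n) h =
  trans (∑-upTo-suc n (λ k → h k - h (suc k)))
  (trans (+-congʳ (h 0 - h 1) (∑-telescope n (h ∘ suc))) (chain (h 0) (h 1) (h (suc n))))
  where
  chain : ∀ a b c → (a - b) + (b - c) ≡ a - c
  chain = solve-∀

-- The factor is the indicator of m ≤ k, so the sum telescopes from m on. It is written `m <ᵇ suc k`
-- because `gtR` yields this when a letter of absolute value k + 1 is compared with one of absolute
-- value m and the same sign.
∑-abel : ∀ {m n} → m ≤ n → ∀ (h : ℕ → ℤ) →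
  (∑[ k ∈ upTo n ] ⟦ m <ᵇ suc k ⟧ * (h k - h (suc k))) ≡ h m - h n
∑-abel {n = n} z≤n h =
  trans (∑-cong (upTo n) (λ k → ℤ.*-identityˡ (h k - h (suc k)))) (∑-telescope n h)
∑-abel (s≤s {m} {n} m≤n) h = begin
  (∑[ k ∈ upTo (suc n) ] ⟦ suc m <ᵇ suc k ⟧ * (h k - h (suc k)))
    ≡⟨ ∑-upTo-suc n (λ k → ⟦ suc m <ᵇ suc k ⟧ * (h k - h (suc k))) ⟩
  + 0 + (∑[ k ∈ upTo n ] ⟦ m <ᵇ suc k ⟧ * (h (suc k) - h (suc (suc k))))
    ≡⟨ ℤ.+-identityˡ _ ⟩
  (∑[ k ∈ upTo n ] ⟦ m <ᵇ suc k ⟧ * (h (suc k) - h (suc (suc k))))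
    ≡⟨ ∑-abel m≤n (h ∘ suc) ⟩
  h (suc m) - h (suc n) ∎

-- Insertion into words and descents

-- punch q is the increasing injection of ℕ into itself that omits q.
punch : ℕ → ℕ → ℕ
punch zero    k       = suc k
punch (suc q) zero    = zero
punch (suc q) (suc k) = suc (punch q k)

punch-injective : ∀ q {k l} → punch q k ≡ punch q l → k ≡ l
punch-injective zero                      eq = ℕ.suc-injective eq
punch-injective (suc q) {zero}  {zero}    eq = refl
punch-injective (suc q) {suc k} {suc l}   eq = cong suc (punch-injective q (ℕ.suc-injective eq))

punch≢ : ∀ q k → q ≢ punch q k
punch≢ (suc q) (suc k) eq = punch≢ q k (ℕ.suc-injective eq)

punch-< : ∀ {q k} → k < q → punch q k ≡ k
punch-< {suc q} {zero}  _           = refl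
punch-< {suc q} {suc k} (s≤s k<q) = cong suc (punch-< k<q)

punch-≥ : ∀ {q k} → q ≤ k → punch q k ≡ suc k
punch-≥ z≤n       = refl
punch-≥ (s≤s q≤k) = cong suc (punch-≥ q≤k)

punch-bound : ∀ q {k n} → k < n → punch q k < suc n
punch-bound zero            k<n       = s≤s k<n
punch-bound (suc q) {zero}  k<n       = s≤s z≤n
punch-bound (suc q) {suc k} (s≤s k<n) = s≤s (punch-bound q k<n)

punch-surjective : ∀ {q k n} → q ≤ n → k < suc n → q ≢ k → ∃ λ l → l < n × punch q l ≡ k
punch-surjective {zero}  {zero}          _         _         q≢k = contradiction refl q≢k
punch-surjective {zero}  {suc k}         _         (s≤s k<n) q≢k = k , k<n , refl
punch-surjective {suc q} {zero}  {suc n} _         _         q≢k = 0 , s≤s z≤n , refl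
punch-surjective {suc q} {suc k}         (s≤s q≤n) (s≤s k<n) q≢k
  with l , l<n , eq ← punch-surjective q≤n k<n (q≢k ∘ cong suc) = suc l , s≤s l<n , cong suc eq

punch-mono-<ᵇ : ∀ q k l → (punch q k <ᵇ punch q l) ≡ (k <ᵇ l)
punch-mono-<ᵇ zero    k       l       = refl
punch-mono-<ᵇ (suc q) zero    zero    = refl
punch-mono-<ᵇ (suc q) zero    (suc l) = refl
punch-mono-<ᵇ (suc q) (suc k) zero    = refl
punch-mono-<ᵇ (suc q) (suc k) (suc l) = punch-mono-<ᵇ q k l

punch-below : ∀ q k → (punch q k <ᵇ q) ≡ (k <ᵇ q)
punch-below zero    k       = refl
punch-below (suc q) zero    = refl
punch-below (suc q) (suc k) = punch-below q k

punch-above : ∀ q k → (q <ᵇ punch q k) ≡ not (k <ᵇ q)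
punch-above zero    k       = refl
punch-above (suc q) zero    = refl
punch-above (suc q) (suc k) = punch-above q k

-- Makes room for a new letter ±(q + 1) by raising the absolute values above q.
bump : ℕ → ℤ → ℤ
bump q (+ a)    = + punch (suc q) a
bump q -[1+ a ] = -[1+ punch q a ]

∣bump∣ : ∀ q x → ∣ bump q x ∣ ≡ punch (suc q) ∣ x ∣
∣bump∣ q (+ a)    = refl
∣bump∣ q -[1+ a ] = refl

sign-bump : ∀ q x → sign (bump q x) ≡ sign x
sign-bump q (+ a)    = refl
sign-bump q -[1+ a ] = refl

bump-◃ : ∀ q s k → bump q (s ◃ suc k) ≡ s ◃ suc (punch q k)
bump-◃ q Sign.+ k = refl
bump-◃ q Sign.- k = refl

gtR-bump : ∀ q x y → gtR (bump q x) (bump q y) ≡ gtR x y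
gtR-bump q (+ a) (+ b)
  rewrite isYes≗does (punch (suc q) b ℕ.<? punch (suc q) a) | isYes≗does (b ℕ.<? a)
  = punch-mono-<ᵇ (suc q) b a
gtR-bump q (+ a)    -[1+ b ] = refl
gtR-bump q -[1+ a ] (+ b)    = refl
gtR-bump q -[1+ a ] -[1+ b ]
  rewrite isYes≗does (punch q b ℕ.<? punch q a) | isYes≗does (b ℕ.<? a)
  = punch-mono-<ᵇ q b a

-- Only absolute values of at least q + 1 are moved. Within the sign of the new letter such letters
-- are not below it, before or after the move; between opposite signs the absolute values do not
-- matter.
gtR-slotˡ : ∀ s q x → gtR (s ◃ suc q) (bump q x) ≡ gtR (s ◃ suc q) x
gtR-slotˡ Sign.+ q (+ a)
  rewrite isYes≗does (punch (suc q) a ℕ.<? suc q) | isYes≗does (a ℕ.<? suc q)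
  = punch-below (suc q) a
gtR-slotˡ Sign.+ q -[1+ a ] = refl
gtR-slotˡ Sign.- q (+ a)    = refl
gtR-slotˡ Sign.- q -[1+ a ]
  rewrite isYes≗does (punch q a ℕ.<? q) | isYes≗does (a ℕ.<? q)
  = punch-below q a

-- A bumped letter never equals the new letter, so exactly one of the two strict comparisons holds.
-- This is the source of the summand 1 in the change of the descent number.
gtR-slotʳ : ∀ s q x → gtR (bump q x) (s ◃ suc q) ≡ not (gtR (s ◃ suc q) x)
gtR-slotʳ Sign.+ q (+ a)
  rewrite isYes≗does (suc q ℕ.<? punch (suc q) a) | isYes≗does (a ℕ.<? suc q)
  = punch-above (suc q) a
gtR-slotʳ Sign.+ q -[1+ a ] = refl
gtR-slotʳ Sign.- q (+ a)    = refl
gtR-slotʳ Sign.- q -[1+ a ]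
  rewrite isYes≗does (q ℕ.<? punch q a) | isYes≗does (a ℕ.<? q)
  = punch-above q a

insert : ℕ → A → List A → List A
insert zero    v xs       = v ∷ xs
insert (suc p) v []       = v ∷ []
insert (suc p) v (x ∷ xs) = x ∷ insert p v xs

insert-↭ : ∀ p (v : A) xs → insert p v xs ↭ v ∷ xs
insert-↭ zero    v xs       = ↭-refl
insert-↭ (suc p) v []       = ↭-refl
insert-↭ (suc p) v (x ∷ xs) = ↭-trans (prep x (insert-↭ p v xs)) (swap x v ↭-refl)

applyUpTo-insert : ∀ (f : ℕ → A) {q m} → q ≤ m →
  applyUpTo f (suc m) ≡ insert q (f q) (applyUpTo (f ∘ punch q) m)
applyUpTo-insert f z≤n       = refl
applyUpTo-insert f (s≤s q≤m) = cong (f 0 ∷_) (applyUpTo-insert (f ∘ suc) q≤m)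

applyUpTo-cong : ∀ {f g : ℕ → A} → f ≗ g → ∀ n → applyUpTo f n ≡ applyUpTo g n
applyUpTo-cong f≗g zero    = refl
applyUpTo-cong f≗g (suc n) = cong₂ _∷_ (f≗g 0) (applyUpTo-cong (f≗g ∘ suc) n)

nth : A → List A → ℕ → A
nth d []       k       = d
nth d (x ∷ xs) zero    = x
nth d (x ∷ xs) (suc k) = nth d xs k

-- Equals 1 if inserting a letter v between the p-th and the next letter creates no descent, else 0.
stay : (ℕ → ℤ) → ℕ → ℤ → ℤ
stay f p v = ⟦ gtR (f p) (f (suc p)) ⟧ + (⟦ gtR v (f p) ⟧ - ⟦ gtR v (f (suc p)) ⟧)

-- The value -1 would need m ≤ k < r without m < r, and the value 2 would need k < m < r without k <
-- r.
between-0-1 : ∀ k m r →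
  (⟦ k <ᵇ m ⟧ + (⟦ m <ᵇ r ⟧ - ⟦ k <ᵇ r ⟧) ≡ + 0) ⊎ (⟦ k <ᵇ m ⟧ + (⟦ m <ᵇ r ⟧ - ⟦ k <ᵇ r ⟧) ≡ + 1)
between-0-1 zero    zero    zero    = inj₁ refl
between-0-1 zero    zero    (suc r) = inj₁ refl
between-0-1 zero    (suc m) zero    = inj₂ refl
between-0-1 zero    (suc m) (suc r) with m <ᵇ r
... | true  = inj₂ refl
... | false = inj₁ refl
between-0-1 (suc k) zero    zero    = inj₁ refl
between-0-1 (suc k) zero    (suc r) with k <ᵇ r
... | true  = inj₁ refl
... | false = inj₂ refl
between-0-1 (suc k) (suc m) zero    with k <ᵇ m
... | true  = inj₂ refl
... | false = inj₁ refl
between-0-1 (suc k) (suc m) (suc r) = between-0-1 k m r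

-- On letters of one sign the r-order compares absolute values, so `between-0-1` applies to f (p +
-- 1), f p and the new letter. Mixed signs leave a single comparison open.
stay-0-1 : ∀ f p s q → (stay f p (s ◃ suc q) ≡ + 0) ⊎ (stay f p (s ◃ suc q) ≡ + 1)
stay-0-1 f p s q with f p | f (suc p) | s
... | + a      | + b      | Sign.+
  rewrite isYes≗does (b ℕ.<? a) | isYes≗does (a ℕ.<? suc q) | isYes≗does (b ℕ.<? suc q)
  = between-0-1 b a (suc q)
... | + a      | + b      | Sign.-
  with ⌊ b ℕ.<? a ⌋
...   | true  = inj₂ refl
...   | false = inj₁ refl
stay-0-1 f p s q | + a      | -[1+ b ] | Sign.+ with ⌊ a ℕ.<? suc q ⌋
... | true  = inj₂ refl
... | false = inj₁ refl
stay-0-1 f p s q | + a      | -[1+ b ] | Sign.- with ⌊ b ℕ.<? q ⌋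
... | true  = inj₁ refl
... | false = inj₂ refl
stay-0-1 f p s q | -[1+ a ] | + b      | Sign.+ with ⌊ b ℕ.<? suc q ⌋
... | true  = inj₁ refl
... | false = inj₂ refl
stay-0-1 f p s q | -[1+ a ] | + b      | Sign.- with ⌊ a ℕ.<? q ⌋
... | true  = inj₂ refl
... | false = inj₁ refl
stay-0-1 f p s q | -[1+ a ] | -[1+ b ] | Sign.+ with ⌊ b ℕ.<? a ⌋
... | true  = inj₂ refl
... | false = inj₁ refl
stay-0-1 f p s q | -[1+ a ] | -[1+ b ] | Sign.-
  rewrite isYes≗does (b ℕ.<? a) | isYes≗does (a ℕ.<? q) | isYes≗does (b ℕ.<? q)
  = between-0-1 b a q

+descentsFrom-∷ : ∀ a x xs → + descentsFrom a (x ∷ xs) ≡ ⟦ gtR a x ⟧ + + descentsFrom x xs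
+descentsFrom-∷ a x xs with gtR a x
... | true  = refl
... | false = refl

-- The last pair compares the final letter with the default t, which no letter exceeds, so it adds
-- nothing.
descentsFrom-∑ : ∀ t a xs → All (λ x → gtR x t ≡ false) (a ∷ xs) →
  (∑[ p ∈ upTo (suc (length xs)) ] ⟦ gtR (nth t (a ∷ xs) p) (nth t (a ∷ xs) (suc p)) ⟧)
    ≡ + descentsFrom a xs
descentsFrom-∑ t a []       (a≯t ∷ [])  rewrite a≯t = refl
descentsFrom-∑ t a (x ∷ xs) (a≯t ∷ x∷xs≯t) = begin
  ∑ (upTo (suc (suc (length xs)))) D                      ≡⟨ ∑-upTo-suc (suc (length xs)) D ⟩
  ⟦ gtR a x ⟧ + ∑ (upTo (suc (length xs))) (D ∘ suc)      ≡⟨ +-congʳ ⟦ gtR a x ⟧ (descentsFrom-∑ t x xs x∷xs≯t) ⟩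
  ⟦ gtR a x ⟧ + + descentsFrom x xs                       ≡⟨ +descentsFrom-∷ a x xs ⟨
  + descentsFrom a (x ∷ xs)                               ∎
  where
  D : ℕ → ℤ
  D p = ⟦ gtR (nth t (a ∷ x ∷ xs) p) (nth t (a ∷ x ∷ xs) (suc p)) ⟧

⟦not⟧ : ∀ b → ⟦ not b ⟧ ≡ + 1 - ⟦ b ⟧
⟦not⟧ true  = refl
⟦not⟧ false = refl

descentsFrom-map-bump : ∀ q a xs → descentsFrom (bump q a) (map (bump q) xs) ≡ descentsFrom a xs
descentsFrom-map-bump q a []       = refl
descentsFrom-map-bump q a (x ∷ xs) rewrite gtR-bump q a x =
  cong ((if gtR a x then 1 else 0) ℕ.+_) (descentsFrom-map-bump q x xs)

-- t plays the role of an extra last letter +∞.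
descentsFrom-insert : ∀ t s q a xs {p} → p ≤ length xs →
  All (λ x → gtR x t ≡ false) (a ∷ xs) → gtR (s ◃ suc q) t ≡ false →
  + descentsFrom (bump q a) (insert p (s ◃ suc q) (map (bump q) xs))
    ≡ + descentsFrom a xs + (+ 1 - stay (nth t (a ∷ xs)) p (s ◃ suc q))
descentsFrom-insert t s q a [] z≤n (a≯t ∷ []) v≯t
  rewrite +descentsFrom-∷ (bump q a) (s ◃ suc q) [] | gtR-slotʳ s q a | a≯t | v≯t
        | ⟦not⟧ (gtR (s ◃ suc q) a)
  = arith ⟦ gtR (s ◃ suc q) a ⟧
  where
  arith : ∀ g → (+ 1 - g) + + 0 ≡ + 0 + (+ 1 - (+ 0 + (g - + 0)))
  arith = solve-∀
-- The pair (a, b) gives way to (a, v) and (v, b), where v is the new letter. The first contributes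
-- 1 - [v > a] by `gtR-slotʳ`, the second [v > b].
descentsFrom-insert t s q a (b ∷ xs) z≤n _ _
  rewrite +descentsFrom-∷ (bump q a) (s ◃ suc q) (bump q b ∷ map (bump q) xs)
        | +descentsFrom-∷ (s ◃ suc q) (bump q b) (map (bump q) xs)
        | +descentsFrom-∷ a b xs
        | descentsFrom-map-bump q b xs
        | gtR-slotʳ s q a | gtR-slotˡ s q b
        | ⟦not⟧ (gtR (s ◃ suc q) a)
  = arith ⟦ gtR (s ◃ suc q) a ⟧ ⟦ gtR (s ◃ suc q) b ⟧ ⟦ gtR a b ⟧ (+ descentsFrom b xs)
  where
  arith : ∀ g h k d → (+ 1 - g) + (h + d) ≡ (k + d) + (+ 1 - (k + (g - h)))
  arith = solve-∀
descentsFrom-insert t s q a (b ∷ xs) {suc p} (s≤s p≤) (_ ∷ b∷xs≯t) v≯t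
  rewrite +descentsFrom-∷ (bump q a) (bump q b) (insert p (s ◃ suc q) (map (bump q) xs))
        | +descentsFrom-∷ a b xs
        | descentsFrom-insert t s q b xs p≤ b∷xs≯t v≯t
        | gtR-bump q a b
  = arith ⟦ gtR a b ⟧ (+ descentsFrom b xs) _
  where
  arith : ∀ g d r → g + (d + r) ≡ (g + d) + r
  arith = solve-∀

-- Inverses and signed permutations

signed-index : ∀ x i →
  (if ⌊ x ℤ.<? + 0 ⌋ then ℤ.- (+ suc i) else + suc i) ≡ sign x ◃ suc i
signed-index (+ a)    i = refl
signed-index -[1+ a ] i = refl

invAux-here : ∀ {k} i x xs → ∣ x ∣ ≡ k → invAux k (suc i) (x ∷ xs) ≡ sign x ◃ suc i
invAux-here {k} i x xs eq with ∣ x ∣ ℕ.≟ k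
... | yes _ = signed-index x i
... | no ne = contradiction eq ne

invAux-there : ∀ {k} i x xs → ∣ x ∣ ≢ k → invAux k i (x ∷ xs) ≡ invAux k (suc i) xs
invAux-there {k} i x xs ne with ∣ x ∣ ℕ.≟ k
... | yes eq = contradiction eq ne
... | no _   = refl

∣bump∣≢ : ∀ q x → ∣ bump q x ∣ ≢ suc q
∣bump∣≢ q x eq = punch≢ (suc q) ∣ x ∣ (trans (sym eq) (∣bump∣ q x))

-- Behind the insertion point every position is one higher. As p ≤ i, each position found exceeds p,
-- so `bump p` adds exactly this one; an unsuccessful search returns 0, which `bump p` fixes.
invAux-map-bump : ∀ q k i p xs → p ≤ i →
  invAux (punch (suc q) k) (suc (suc i)) (map (bump q) xs) ≡ bump p (invAux k (suc i) xs)
invAux-map-bump q k i p []       p≤i = refl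
invAux-map-bump q k i p (x ∷ xs) p≤i with ∣ x ∣ ℕ.≟ k
... | yes refl = begin
  invAux (punch (suc q) ∣ x ∣) (suc (suc i)) (bump q x ∷ map (bump q) xs)
                               ≡⟨ invAux-here (suc i) (bump q x) (map (bump q) xs) (∣bump∣ q x) ⟩
  sign (bump q x) ◃ suc (suc i) ≡⟨ cong₂ (λ s j → s ◃ suc j) (sign-bump q x) (sym (punch-≥ p≤i)) ⟩
  sign x ◃ suc (punch p i)      ≡⟨ bump-◃ p (sign x) i ⟨
  bump p (sign x ◃ suc i)       ≡⟨ cong (bump p) (signed-index x i) ⟨
  _ ∎
... | no ne = begin
  invAux (punch (suc q) k) (suc (suc i)) (bump q x ∷ map (bump q) xs)
    ≡⟨ invAux-there (suc (suc i)) (bump q x) (map (bump q) xs)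
         (λ eq → ne (punch-injective (suc q) (trans (sym (∣bump∣ q x)) eq))) ⟩
  invAux (punch (suc q) k) (suc (suc (suc i))) (map (bump q) xs)
    ≡⟨ invAux-map-bump q k (suc i) p xs (ℕ.m≤n⇒m≤1+n p≤i) ⟩
  bump p (invAux k (suc (suc i)) xs) ∎

∣◃∣ : ∀ s k → ∣ s ◃ suc k ∣ ≡ suc k
∣◃∣ s k = ℤ.abs-◃ s (suc k)

-- Here i letters have been passed and p remain before the slot, so i + p is constant along the
-- recursion. Letters found before the slot keep their position, those behind it move up by one.
invAux-insert-old : ∀ s q k i p xs → p ≤ length xs →
  invAux (punch (suc q) k) (suc i) (insert p (s ◃ suc q) (map (bump q) xs))
    ≡ bump (i ℕ.+ p) (invAux k (suc i) xs)
invAux-insert-old s q k i zero xs _ = begin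
  invAux (punch (suc q) k) (suc i) ((s ◃ suc q) ∷ map (bump q) xs)
    ≡⟨ invAux-there (suc i) (s ◃ suc q) (map (bump q) xs) (λ eq → punch≢ (suc q) k (trans (sym (∣◃∣ s q)) eq)) ⟩
  invAux (punch (suc q) k) (suc (suc i)) (map (bump q) xs)
    ≡⟨ invAux-map-bump q k i (i ℕ.+ 0) xs (ℕ.≤-reflexive (ℕ.+-identityʳ i)) ⟩
  bump (i ℕ.+ 0) (invAux k (suc i) xs) ∎
invAux-insert-old s q k i (suc p) (x ∷ xs) (s≤s p≤) with ∣ x ∣ ℕ.≟ k
... | yes refl = begin
  invAux (punch (suc q) ∣ x ∣) (suc i) (bump q x ∷ insert p (s ◃ suc q) (map (bump q) xs))
    ≡⟨ invAux-here i (bump q x) (insert p (s ◃ suc q) (map (bump q) xs)) (∣bump∣ q x) ⟩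
  sign (bump q x) ◃ suc i
    ≡⟨ cong₂ (λ s j → s ◃ suc j) (sign-bump q x) (sym (punch-< (ℕ.m<m+n i (s≤s z≤n)))) ⟩
  sign x ◃ suc (punch (i ℕ.+ suc p) i)
    ≡⟨ bump-◃ (i ℕ.+ suc p) (sign x) i ⟨
  bump (i ℕ.+ suc p) (sign x ◃ suc i)
    ≡⟨ cong (bump (i ℕ.+ suc p)) (signed-index x i) ⟨
  _ ∎
... | no ne = begin
  invAux (punch (suc q) k) (suc i) (bump q x ∷ insert p (s ◃ suc q) (map (bump q) xs))
    ≡⟨ invAux-there (suc i) (bump q x) (insert p (s ◃ suc q) (map (bump q) xs))
         (λ eq → ne (punch-injective (suc q) (trans (sym (∣bump∣ q x)) eq))) ⟩
  invAux (punch (suc q) k) (suc (suc i)) (insert p (s ◃ suc q) (map (bump q) xs))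
    ≡⟨ invAux-insert-old s q k (suc i) p xs p≤ ⟩
  bump (suc i ℕ.+ p) (invAux k (suc (suc i)) xs)
    ≡⟨ cong (λ j → bump j (invAux k (suc (suc i)) xs)) (ℕ.+-suc i p) ⟨
  bump (i ℕ.+ suc p) (invAux k (suc (suc i)) xs) ∎

invAux-insert-new : ∀ s q i p xs → p ≤ length xs →
  invAux (suc q) (suc i) (insert p (s ◃ suc q) (map (bump q) xs)) ≡ s ◃ suc (i ℕ.+ p)
invAux-insert-new s q i zero xs _ = begin
  invAux (suc q) (suc i) ((s ◃ suc q) ∷ map (bump q) xs) ≡⟨ invAux-here i (s ◃ suc q) (map (bump q) xs) (∣◃∣ s q) ⟩
  sign (s ◃ suc q) ◃ suc i
    ≡⟨ cong₂ (λ s j → s ◃ suc j) (ℤ.sign-◃ s (suc q)) (sym (ℕ.+-identityʳ i)) ⟩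
  s ◃ suc (i ℕ.+ 0) ∎
invAux-insert-new s q i (suc p) (x ∷ xs) (s≤s p≤) = begin
  invAux (suc q) (suc i) (bump q x ∷ insert p (s ◃ suc q) (map (bump q) xs))
    ≡⟨ invAux-there (suc i) (bump q x) (insert p (s ◃ suc q) (map (bump q) xs)) (∣bump∣≢ q x) ⟩
  invAux (suc q) (suc (suc i)) (insert p (s ◃ suc q) (map (bump q) xs))
    ≡⟨ invAux-insert-new s q (suc i) p xs p≤ ⟩
  s ◃ suc (suc i ℕ.+ p)
    ≡⟨ cong (λ j → s ◃ suc j) (ℕ.+-suc i p) ⟨
  s ◃ suc (i ℕ.+ suc p) ∎

inverse≡applyUpTo : ∀ n π → inverse n π ≡ applyUpTo (λ k → invAux (suc k) 1 π) n
inverse≡applyUpTo n π =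
  trans (sym (map-∘ (upTo n))) (map-upTo (λ k → invAux (suc k) 1 π) n)

-- Position and absolute value exchange roles: entry q of the new inverse records where the new
-- letter stands, and the other entries are the old positions, raised beyond the slot p.
inverse-insert : ∀ s {p q m} σ → p ≤ length σ → q ≤ m →
  inverse (suc m) (insert p (s ◃ suc q) (map (bump q) σ))
    ≡ insert q (s ◃ suc p) (map (bump p) (inverse m σ))
inverse-insert s {p} {q} {m} σ p≤ q≤m = begin
  inverse (suc m) π
    ≡⟨ inverse≡applyUpTo (suc m) π ⟩
  applyUpTo (λ k → invAux (suc k) 1 π) (suc m)
    ≡⟨ applyUpTo-insert (λ k → invAux (suc k) 1 π) q≤m ⟩
  insert q (invAux (suc q) 1 π) (applyUpTo (λ k → invAux (suc (punch q k)) 1 π) m)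
    ≡⟨ cong₂ (insert q) (invAux-insert-new s q 0 p σ p≤)
         (applyUpTo-cong (λ k → invAux-insert-old s q (suc k) 0 p σ p≤) m) ⟩
  insert q (s ◃ suc p) (applyUpTo (λ k → bump p (invAux (suc k) 1 σ)) m)
    ≡⟨ cong (insert q (s ◃ suc p))
         (trans (cong (map (bump p)) (inverse≡applyUpTo m σ)) (map-applyUpTo _ (bump p) m)) ⟨
  insert q (s ◃ suc p) (map (bump p) (inverse m σ)) ∎
  where
  π : List ℤ
  π = insert p (s ◃ suc q) (map (bump q) σ)

covers : ∀ {n π} → isSignedPerm n π → ∀ {k} → k < n → Any (λ x → ∣ x ∣ ≡ suc k) π
covers π-perm k<n = All.lookup (All.map⁻ π-perm) (∈-upTo⁺ k<n)

covering : ∀ {n π} → (∀ {k} → k < n → Any (λ x → ∣ x ∣ ≡ suc k) π) → isSignedPerm n π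
covering cov = All.map⁺ (All.tabulate (cov ∘ ∈-upTo⁻))

insert-isSignedPerm⁺ : ∀ s p {q m} σ → q ≤ m → isSignedPerm m σ →
  isSignedPerm (suc m) (insert p (s ◃ suc q) (map (bump q) σ))
insert-isSignedPerm⁺ s p {q} {m} σ q≤m σ-perm = covering cov
  where
  cov : ∀ {k} → k < suc m → Any (λ x → ∣ x ∣ ≡ suc k) (insert p (s ◃ suc q) (map (bump q) σ))
  cov {k} k≤m = Any-resp-↭ (↭-sym (insert-↭ p (s ◃ suc q) (map (bump q) σ))) cov-∷
    where
    cov-∷ : Any (λ x → ∣ x ∣ ≡ suc k) ((s ◃ suc q) ∷ map (bump q) σ)
    cov-∷ with q ℕ.≟ k
    ... | yes refl = here (∣◃∣ s q)
    ... | no q≢k with l , l<m , refl ← punch-surjective q≤m k≤m q≢k =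
      there (Any.map⁺ (Any.map (λ {x} eq → trans (∣bump∣ q x) (cong (punch (suc q)) eq)) (covers σ-perm l<m)))

insert-isSignedPerm⁻ : ∀ s p {q m} σ → isSignedPerm (suc m) (insert p (s ◃ suc q) (map (bump q) σ)) →
  isSignedPerm m σ
insert-isSignedPerm⁻ s p {q} {m} σ π-perm = covering cov
  where
  cov : ∀ {k} → k < m → Any (λ x → ∣ x ∣ ≡ suc k) σ
  cov {k} k<m with Any-resp-↭ (insert-↭ p (s ◃ suc q) (map (bump q) σ)) (covers π-perm (punch-bound q k<m))
  ... | here eq = contradiction (ℕ.suc-injective (trans (sym (∣◃∣ s q)) eq)) (punch≢ q k)
  ... | there any = Any.map (λ {x} eq → punch-injective (suc q) (trans (sym (∣bump∣ q x)) eq)) (Any.map⁻ any)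

-- The head is removed from both lists; since it does not recur in the tail, the tail still lies in
-- what is left of `ys`.
Unique∧⊆⇒↭ : ∀ {xs ys : List A} → Unique xs → (∀ {x} → x ∈ xs → x ∈ ys) →
  length ys ≡ length xs → xs ↭ ys
Unique∧⊆⇒↭ {xs = []} {[]} _ _ _ = ↭-refl
Unique∧⊆⇒↭ {xs = x ∷ xs} (x∉xs ∷ xs!) xs⊆ys len
  with as , bs , refl ← ∈-∃++ (xs⊆ys (here refl)) =
  ↭-trans (prep x (Unique∧⊆⇒↭ xs! xs⊆as++bs len′)) (↭-sym (shift x as bs))
  where
  xs⊆as++bs : ∀ {y} → y ∈ xs → y ∈ as ++ bs
  xs⊆as++bs y∈xs with ∈-resp-↭ (shift x as bs) (xs⊆ys (there y∈xs))
  ... | here refl = contradiction refl (All.lookup x∉xs y∈xs)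
  ... | there y∈  = y∈
  len′ : length (as ++ bs) ≡ length xs
  len′ = ℕ.suc-injective (trans (sym (↭-length (shift x as bs))) len)

module _ {n π} (∣π∣≡n : length π ≡ n) (π-perm : isSignedPerm n π) where

  -- `isSignedPerm` demands only that each of 1, ..., n occurs. As there are just n letters, none
  -- can be repeated or out of range.
  abs-↭ : applyUpTo suc n ↭ map ∣_∣ π
  abs-↭ = Unique∧⊆⇒↭ (Unique.applyUpTo⁺₁ suc n (λ i<j _ → ℕ.<⇒≢ i<j ∘ ℕ.suc-injective)) ⊆
    (trans (length-map ∣_∣ π) (trans ∣π∣≡n (sym (length-applyUpTo suc n))))
    where
    ⊆ : ∀ {k} → k ∈ applyUpTo suc n → k ∈ map ∣_∣ π
    ⊆ k∈ with i , i∈ , refl ← ∈-map⁻ suc (subst (_ ∈_) (sym (map-upTo suc n)) k∈) =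
      Any.map⁺ (Any.map sym (covers π-perm (∈-upTo⁻ i∈)))

  abs-unique : Unique (map ∣_∣ π)
  abs-unique = Permutationₛ.Unique-resp-↭ (setoid ℕ) (↭⇒↭ₛ abs-↭)
    (Unique.applyUpTo⁺₁ suc n (λ i<j _ → ℕ.<⇒≢ i<j ∘ ℕ.suc-injective))

  abs-range : ∀ {x} → x ∈ π → ∃ λ k → k < n × ∣ x ∣ ≡ suc k
  abs-range x∈π
    with i , i∈ , eq ← ∈-map⁻ suc (subst (_ ∈_) (sym (map-upTo suc n))
                         (∈-resp-↭ (↭-sym abs-↭) (∈-map⁺ ∣_∣ x∈π)))
    = i , ∈-upTo⁻ i∈ , eq

-- The absolute value q + 1 would occur twice, against `abs-unique`. Hence, once the new letter is
-- fixed, only words avoiding ±(q + 1) contribute.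
¬insert-repeated : ∀ s p {q n w} → suc (length w) ≡ n → Any (λ x → ∣ x ∣ ≡ suc q) w →
  ¬ isSignedPerm n (insert p (s ◃ suc q) w)
¬insert-repeated s p {q} {n} {w} len any π-perm
  with v∉ ∷ _ ← Permutationₛ.Unique-resp-↭ (setoid ℕ) (↭⇒↭ₛ (map⁺ ∣_∣ (insert-↭ p (s ◃ suc q) w)))
                  (abs-unique (trans (↭-length (insert-↭ p (s ◃ suc q) w)) len) π-perm)
  = contradiction (∣◃∣ s q) λ eq → All.lookup v∉ (Any.map⁺ (Any.map sym any)) eq

nth-∈ : ∀ (d : A) xs {k} → k < length xs → nth d xs k ∈ xs
nth-∈ d (x ∷ xs) {zero}  _        = here refl
nth-∈ d (x ∷ xs) {suc k} (s≤s k<) = there (nth-∈ d xs k<)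

nth-length : ∀ (d : A) xs → nth d xs (length xs) ≡ d
nth-length d []       = refl
nth-length d (x ∷ xs) = nth-length d xs

nth-applyUpTo : ∀ (d : A) f {n k} → k < n → nth d (applyUpTo f n) k ≡ f k
nth-applyUpTo d f {suc n} {zero}  _        = refl
nth-applyUpTo d f {suc n} {suc k} (s≤s k<) = nth-applyUpTo d (f ∘ suc) k<

-- `invAux` stops at the first letter of the given absolute value; uniqueness makes this the letter
-- at index p.
invAux-nth : ∀ d i xs {p} → Unique (map ∣_∣ xs) → p < length xs →
  invAux ∣ nth d xs p ∣ (suc i) xs ≡ sign (nth d xs p) ◃ suc (i ℕ.+ p)
invAux-nth d i (x ∷ xs) {zero} _ _ =
  trans (invAux-here i x xs refl) (cong (λ j → sign x ◃ suc j) (sym (ℕ.+-identityʳ i)))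
invAux-nth d i (x ∷ xs) {suc p} (x∉ ∷ xs!) (s≤s p<) = begin
  invAux (∣ y ∣) (suc i) (x ∷ xs) ≡⟨ invAux-there (suc i) x xs (All.lookup x∉ (∈-map⁺ ∣_∣ (nth-∈ d xs p<))) ⟩
  invAux (∣ y ∣) (suc (suc i)) xs ≡⟨ invAux-nth d (suc i) xs xs! p< ⟩
  sign y ◃ suc (suc i ℕ.+ p)    ≡⟨ cong (λ j → sign y ◃ suc j) (ℕ.+-suc i p) ⟨
  sign y ◃ suc (i ℕ.+ suc p)    ∎
  where
  y : ℤ
  y = nth d xs p

-- Sums over all insertions

signs : List Sign
signs = Sign.+ ∷ Sign.- ∷ []

⌊<?⌋-true : ∀ {a b} → a < b → ⌊ a ℕ.<? b ⌋ ≡ true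
⌊<?⌋-true {a} {b} a<b = trans (isYes≗does (a ℕ.<? b)) (dec-true (a ℕ.<? b) a<b)

⌊<?⌋-false : ∀ {a b} → b ≤ a → ⌊ a ℕ.<? b ⌋ ≡ false
⌊<?⌋-false {a} {b} b≤a = trans (isYes≗does (a ℕ.<? b)) (dec-false (a ℕ.<? b) (ℕ.≤⇒≯ b≤a))

gtR-top : ∀ s {q n} → q < n → gtR (s ◃ suc q) (+ n) ≡ false
gtR-top Sign.+ q<n = ⌊<?⌋-false q<n
gtR-top Sign.- q<n = refl

desAt : (ℕ → ℤ) → ℕ → ℤ
desAt f p = ⟦ gtR (f p) (f (suc p)) ⟧

-- The telescoping part of `stay`, which is `desAt f p + crossing f p v` by definition. It is 1
-- where f rises from below v to v or above, and -1 where it falls back below v.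
crossing : (ℕ → ℤ) → ℕ → ℤ → ℤ
crossing f p v = ⟦ gtR v (f p) ⟧ - ⟦ gtR v (f (suc p)) ⟧

module _ {n} (f : ℕ → ℤ) (f0≡0 : f 0 ≡ + 0) (fn≡n : f n ≡ + n) where

  ∑-crossing : ∀ s {q} → q < n →
    (∑[ p ∈ upTo n ] crossing f p (s ◃ suc q)) ≡ ⟦ gtR (s ◃ suc q) (+ 0) ⟧
  ∑-crossing s {q} q<n = begin
    (∑[ p ∈ upTo n ] crossing f p (s ◃ suc q))
      ≡⟨ ∑-telescope n (λ p → ⟦ gtR (s ◃ suc q) (f p) ⟧) ⟩
    ⟦ gtR (s ◃ suc q) (f 0) ⟧ - ⟦ gtR (s ◃ suc q) (f n) ⟧
      ≡⟨ cong₂ (λ x y → ⟦ gtR (s ◃ suc q) x ⟧ - ⟦ gtR (s ◃ suc q) y ⟧) f0≡0 fn≡n ⟩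
    ⟦ gtR (s ◃ suc q) (+ 0) ⟧ - ⟦ gtR (s ◃ suc q) (+ n) ⟧
      ≡⟨ cong (λ b → ⟦ gtR (s ◃ suc q) (+ 0) ⟧ - ⟦ b ⟧) (gtR-top s q<n) ⟩
    ⟦ gtR (s ◃ suc q) (+ 0) ⟧ - + 0
      ≡⟨ ℤ.+-identityʳ _ ⟩
    ⟦ gtR (s ◃ suc q) (+ 0) ⟧ ∎

  -- Of the two letters ±(q + 1) only the positive one exceeds 0.
  ∑-signs-crossing : ∀ {q} → q < n →
    (∑[ s ∈ signs ] ∑[ p ∈ upTo n ] crossing f p (s ◃ suc q)) ≡ + 1
  ∑-signs-crossing q<n = ∑-cong signs (λ s → ∑-crossing s q<n)

  ∑-stay : ∀ {q} → q < n →
    (∑[ p ∈ upTo n ] ∑[ s ∈ signs ] stay f p (s ◃ suc q)) ≡ + 2 * ∑ (upTo n) (desAt f) + + 1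
  ∑-stay {q} q<n = begin
    (∑[ p ∈ upTo n ] ∑[ s ∈ signs ] stay f p (s ◃ suc q))
      ≡⟨ ∑-swap (upTo n) signs (λ p s → stay f p (s ◃ suc q)) ⟩
    (∑[ s ∈ signs ] ∑[ p ∈ upTo n ] stay f p (s ◃ suc q))
      ≡⟨ ∑-cong signs (λ s → ∑-+ (upTo n) (desAt f) (λ p → crossing f p (s ◃ suc q))) ⟩
    (∑[ s ∈ signs ] d + (∑[ p ∈ upTo n ] crossing f p (s ◃ suc q)))
      ≡⟨ ∑-+ signs (λ _ → d) (λ s → ∑[ p ∈ upTo n ] crossing f p (s ◃ suc q)) ⟩
    (∑[ s ∈ signs ] d) + (∑[ s ∈ signs ] ∑[ p ∈ upTo n ] crossing f p (s ◃ suc q))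
      ≡⟨ cong₂ _+_ (∑-const signs d) (∑-signs-crossing q<n) ⟩
    + 2 * d + + 1 ∎
    where
    d : ℤ
    d = ∑ (upTo n) (desAt f)

  ∑-stay-all :
    (∑[ p ∈ upTo n ] ∑[ q ∈ upTo n ] ∑[ s ∈ signs ] stay f p (s ◃ suc q))
      ≡ + n * (+ 2 * ∑ (upTo n) (desAt f) + + 1)
  ∑-stay-all = begin
    (∑[ p ∈ upTo n ] ∑[ q ∈ upTo n ] ∑[ s ∈ signs ] stay f p (s ◃ suc q))
      ≡⟨ ∑-swap (upTo n) (upTo n) (λ p q → ∑[ s ∈ signs ] stay f p (s ◃ suc q)) ⟩
    (∑[ q ∈ upTo n ] ∑[ p ∈ upTo n ] ∑[ s ∈ signs ] stay f p (s ◃ suc q))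
      ≡⟨ ∑-cong-< n (λ q → ∑-stay) ⟩
    (∑[ q ∈ upTo n ] (+ 2 * ∑ (upTo n) (desAt f) + + 1))
      ≡⟨ ∑-upTo-const n _ ⟩
    + n * (+ 2 * ∑ (upTo n) (desAt f) + + 1) ∎

-- Row p of the sum of products of crossings is the difference of two such sums, taken at x = f p
-- and at x = f (p + 1).
weightedCrossing : ℕ → (ℕ → ℤ) → ℕ → ℤ → ℤ
weightedCrossing n g p x =
  ∑[ q ∈ upTo n ] ∑[ s ∈ signs ] ⟦ gtR (s ◃ suc q) x ⟧ * crossing g q (s ◃ suc p)

module _ {n} (g : ℕ → ℤ) (gn≡n : g n ≡ + n) {p} (p<n : p < n) where

  private
    h : Sign → ℕ → ℤ
    h s q = ⟦ gtR (s ◃ suc p) (g q) ⟧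

    h-n : ∀ s → h s n ≡ + 0
    h-n s rewrite gn≡n | gtR-top s p<n = refl

  -- No negative letter exceeds m, and `+ suc q` does so just when m ≤ q. Abel summation leaves the
  -- boundary terms at m and n, and the latter vanishes because g n = n is on top.
  weightedCrossing-+ : ∀ {m} → m ≤ n → weightedCrossing n g p (+ m) ≡ h Sign.+ m
  weightedCrossing-+ {m} m≤n = begin
    weightedCrossing n g p (+ m)
      ≡⟨ ∑-cong (upTo n) (λ q → trans
           (drop-0 (⟦ gtR (+ suc q) (+ m) ⟧ * crossing g q (+ suc p)) (crossing g q -[1+ p ]))
           (cong (λ b → ⟦ b ⟧ * crossing g q (+ suc p)) (isYes≗does (m ℕ.<? suc q)))) ⟩
    (∑[ q ∈ upTo n ] ⟦ m <ᵇ suc q ⟧ * crossing g q (+ suc p))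
      ≡⟨ ∑-abel m≤n (h Sign.+) ⟩
    h Sign.+ m - h Sign.+ n
      ≡⟨ cong (λ z → h Sign.+ m - z) (h-n Sign.+) ⟩
    h Sign.+ m - + 0
      ≡⟨ ℤ.+-identityʳ _ ⟩
    h Sign.+ m ∎
    where
    drop-0 : ∀ a b → a + (+ 0 * b + + 0) ≡ a
    drop-0 = solve-∀

  -- Every positive letter exceeds -(k + 1), so the positive part telescopes from 0. The letter -(q
  -- + 1) exceeds it just when k < q, so the negative part starts at k + 1.
  weightedCrossing-- : ∀ {k} → k < n → weightedCrossing n g p -[1+ k ] ≡ h Sign.+ 0 + h Sign.- (suc k)
  weightedCrossing-- {k} k<n = begin
    weightedCrossing n g p -[1+ k ]
      ≡⟨ ∑-cong (upTo n) (λ q → trans (drop-1 (crossing g q (+ suc p)) _)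
           (cong (λ b → crossing g q (+ suc p) + ⟦ b ⟧ * crossing g q -[1+ p ]) (isYes≗does (k ℕ.<? q)))) ⟩
    (∑[ q ∈ upTo n ] crossing g q (+ suc p) + ⟦ suc k <ᵇ suc q ⟧ * crossing g q -[1+ p ])
      ≡⟨ ∑-+ (upTo n) (λ q → crossing g q (+ suc p)) (λ q → ⟦ suc k <ᵇ suc q ⟧ * crossing g q -[1+ p ]) ⟩
    (∑[ q ∈ upTo n ] crossing g q (+ suc p))
      + (∑[ q ∈ upTo n ] ⟦ suc k <ᵇ suc q ⟧ * crossing g q -[1+ p ])
      ≡⟨ cong₂ _+_ (∑-telescope n (h Sign.+)) (∑-abel k<n (h Sign.-)) ⟩
    (h Sign.+ 0 - h Sign.+ n) + (h Sign.- (suc k) - h Sign.- n)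
      ≡⟨ cong₂ (λ y z → (h Sign.+ 0 - y) + (h Sign.- (suc k) - z)) (h-n Sign.+) (h-n Sign.-) ⟩
    (h Sign.+ 0 - + 0) + (h Sign.- (suc k) - + 0)
      ≡⟨ cong₂ _+_ (ℤ.+-identityʳ (h Sign.+ 0)) (ℤ.+-identityʳ (h Sign.- (suc k))) ⟩
    h Sign.+ 0 + h Sign.- (suc k) ∎
    where
    drop-1 : ∀ a b → + 1 * a + (b + + 0) ≡ a + b
    drop-1 = solve-∀

isNegative : ℤ → ℤ
isNegative (+ _)    = + 0
isNegative -[1+ _ ] = + 1

module _ {n} (f g : ℕ → ℤ) (f0≡0 : f 0 ≡ + 0) (fn≡n : f n ≡ + n) (g0≡0 : g 0 ≡ + 0) (gn≡n : g n ≡ + n)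
         (f-bound : ∀ {p} → p ≤ n → ∣ f p ∣ ≤ n) (g-inverse : ∀ {p} → p ≤ n → g ∣ f p ∣ ≡ sign (f p) ◃ p) where

  -- Here g takes |f p| back to ±p with the sign of f p, and ±(p + 1) with that sign lies above it:
  -- this gives the 1. For negative f p the positive letter p + 1 > g 0 = 0 adds another 1.
  weightedCrossing-this : ∀ {p} (p<n : p < n) → weightedCrossing n g p (f p) ≡ + 1 + isNegative (f p)
  weightedCrossing-this {p} p<n with f p in fp≡ | f-bound (ℕ.<⇒≤ p<n) | g-inverse (ℕ.<⇒≤ p<n)
  ... | + m | m≤n | gm
    = trans (weightedCrossing-+ g gn≡n p<n m≤n) (trans (cong (λ x → ⟦ gtR (+ suc p) x ⟧) (trans gm (ℤ.+◃n≡+n p)))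
        (cong ⟦_⟧ (⌊<?⌋-true (ℕ.n<1+n p))))
  -- f 0 = 0 is not negative.
  weightedCrossing-this {zero}  p<n | -[1+ k ] | _ | _ with () ← trans (sym f0≡0) fp≡
  weightedCrossing-this {suc p} p<n | -[1+ k ] | k<n | gk
    = trans (weightedCrossing-- g gn≡n p<n k<n)
        (trans (cong₂ (λ x y → ⟦ gtR (+ suc (suc p)) x ⟧ + ⟦ gtR -[1+ suc p ] y ⟧) g0≡0 gk)
          (cong (λ b → + 1 + ⟦ b ⟧) (⌊<?⌋-true (ℕ.n<1+n p))))

  -- Now g returns ±(p + 1) itself, which is not strictly below the letter compared with it, so only
  -- the contribution from g 0 in the negative case survives.
  weightedCrossing-next : ∀ {p} (p<n : p < n) → weightedCrossing n g p (f (suc p)) ≡ isNegative (f (suc p))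
  weightedCrossing-next {p} p<n with f (suc p) | f-bound p<n | g-inverse p<n
  ... | + m | m≤n | gm
    = trans (weightedCrossing-+ g gn≡n p<n m≤n) (trans (cong (λ x → ⟦ gtR (+ suc p) x ⟧) gm)
        (cong ⟦_⟧ (⌊<?⌋-false (ℕ.≤-refl {suc p}))))
  ... | -[1+ k ] | k<n | gk
    = trans (weightedCrossing-- g gn≡n p<n k<n)
        (trans (cong₂ (λ x y → ⟦ gtR (+ suc p) x ⟧ + ⟦ gtR -[1+ p ] y ⟧) g0≡0 gk)
          (cong (λ b → + 1 + ⟦ b ⟧) (⌊<?⌋-false (ℕ.≤-refl {p}))))

  ∑-crossing² :
    (∑[ p ∈ upTo n ] ∑[ q ∈ upTo n ] ∑[ s ∈ signs ] crossing f p (s ◃ suc q) * crossing g q (s ◃ suc p)) ≡ + n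
  ∑-crossing² = begin
    (∑[ p ∈ upTo n ] ∑[ q ∈ upTo n ] ∑[ s ∈ signs ] crossing f p (s ◃ suc q) * crossing g q (s ◃ suc p))
      ≡⟨ ∑-cong-< n row ⟩
    (∑[ p ∈ upTo n ] + 1 + (isNegative (f p) - isNegative (f (suc p))))
      ≡⟨ ∑-+ (upTo n) (λ _ → + 1) (λ p → isNegative (f p) - isNegative (f (suc p))) ⟩
    (∑[ p ∈ upTo n ] + 1) + (∑[ p ∈ upTo n ] isNegative (f p) - isNegative (f (suc p)))
      ≡⟨ cong₂ _+_ (∑-upTo-const n (+ 1)) (∑-telescope n (isNegative ∘ f)) ⟩
    + n * + 1 + (isNegative (f 0) - isNegative (f n))
      ≡⟨ cong₂ (λ x y → + n * + 1 + (isNegative x - isNegative y)) f0≡0 fn≡n ⟩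
    + n * + 1 + + 0
      ≡⟨ trans (ℤ.+-identityʳ _) (ℤ.*-identityʳ (+ n)) ⟩
    + n ∎
    where
    -- Subtraction is written as adding -1 times a term, so that `∑-+` and `∑-*ˡ` carry it through
    -- the double sum.
    distrib : ∀ a b c → (a - b) * c ≡ a * c + (ℤ.- + 1) * (b * c)
    distrib = solve-∀
    finish : ∀ a b → (+ 1 + a) + (ℤ.- + 1) * b ≡ + 1 + (a - b)
    finish = solve-∀
    ∑² : (ℕ → Sign → ℤ) → ℤ
    ∑² F = ∑[ q ∈ upTo n ] ∑[ s ∈ signs ] F q s
    ∑²-linear : ∀ F G → ∑² (λ q s → F q s + (ℤ.- + 1) * G q s) ≡ ∑² F + (ℤ.- + 1) * ∑² G
    ∑²-linear F G = begin
      ∑² (λ q s → F q s + (ℤ.- + 1) * G q s)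
        ≡⟨ ∑-cong (upTo n) (λ q → trans (∑-+ signs (F q) (λ s → (ℤ.- + 1) * G q s))
             (+-congʳ (∑ signs (F q)) (∑-*ˡ signs (ℤ.- + 1) (G q)))) ⟩
      (∑[ q ∈ upTo n ] ∑ signs (F q) + (ℤ.- + 1) * ∑ signs (G q))
        ≡⟨ ∑-+ (upTo n) (λ q → ∑ signs (F q)) (λ q → (ℤ.- + 1) * ∑ signs (G q)) ⟩
      ∑² F + (∑[ q ∈ upTo n ] (ℤ.- + 1) * ∑ signs (G q))
        ≡⟨ +-congʳ (∑² F) (∑-*ˡ (upTo n) (ℤ.- + 1) (λ q → ∑ signs (G q))) ⟩
      ∑² F + (ℤ.- + 1) * ∑² G ∎
    row : ∀ p → p < n →
      (∑[ q ∈ upTo n ] ∑[ s ∈ signs ] crossing f p (s ◃ suc q) * crossing g q (s ◃ suc p))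
        ≡ + 1 + (isNegative (f p) - isNegative (f (suc p)))
    row p p<n = begin
      ∑² (λ q s → crossing f p (s ◃ suc q) * crossing g q (s ◃ suc p))
        ≡⟨ ∑-cong (upTo n) (λ q → ∑-cong signs (λ s →
             distrib ⟦ gtR (s ◃ suc q) (f p) ⟧ ⟦ gtR (s ◃ suc q) (f (suc p)) ⟧ (crossing g q (s ◃ suc p)))) ⟩
      ∑² (λ q s → F q s + (ℤ.- + 1) * G q s)
        ≡⟨ ∑²-linear F G ⟩
      ∑² F + (ℤ.- + 1) * ∑² G
        ≡⟨ cong₂ (λ y z → y + (ℤ.- + 1) * z) (weightedCrossing-this p<n) (weightedCrossing-next p<n) ⟩
      (+ 1 + isNegative (f p)) + (ℤ.- + 1) * isNegative (f (suc p))
        ≡⟨ finish (isNegative (f p)) (isNegative (f (suc p))) ⟩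
      + 1 + (isNegative (f p) - isNegative (f (suc p))) ∎
      where
      F G : ℕ → Sign → ℤ
      F q s = ⟦ gtR (s ◃ suc q) (f p) ⟧ * crossing g q (s ◃ suc p)
      G q s = ⟦ gtR (s ◃ suc q) (f (suc p)) ⟧ * crossing g q (s ◃ suc p)

  -- Writing D for `desAt` and C for `crossing`, the product splits as X Y = X D_g + D_f C_g + C_f
  -- C_g. The first two parts factor after summing over one index and the sign, giving (2d + 1) e
  -- and d; the third gives n.
  ∑-stay² :
    (∑[ p ∈ upTo n ] ∑[ q ∈ upTo n ] ∑[ s ∈ signs ] stay f p (s ◃ suc q) * stay g q (s ◃ suc p))
      ≡ + n + ∑ (upTo n) (desAt f) + ∑ (upTo n) (desAt g)
          + + 2 * ∑ (upTo n) (desAt f) * ∑ (upTo n) (desAt g)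
  ∑-stay² = begin
    (∑[ p ∈ upTo n ] ∑[ q ∈ upTo n ] ∑[ s ∈ signs ] stay f p (s ◃ suc q) * stay g q (s ◃ suc p))
      ≡⟨ ∑-cong (upTo n) (λ p → ∑-cong (upTo n) (λ q → split p q)) ⟩
    (∑[ p ∈ upTo n ] ∑[ q ∈ upTo n ] (T₁ p q + (T₂ p q + T₃ p q)))
      ≡⟨ ∑-cong (upTo n) (λ p → trans (∑-+ (upTo n) (T₁ p) (λ q → T₂ p q + T₃ p q))
           (+-congʳ (∑ (upTo n) (T₁ p)) (∑-+ (upTo n) (T₂ p) (T₃ p)))) ⟩
    (∑[ p ∈ upTo n ] ∑ (upTo n) (T₁ p) + (∑ (upTo n) (T₂ p) + ∑ (upTo n) (T₃ p)))
      ≡⟨ trans (∑-+ (upTo n) (λ p → ∑ (upTo n) (T₁ p)) (λ p → ∑ (upTo n) (T₂ p) + ∑ (upTo n) (T₃ p)))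
           (+-congʳ (∑[ p ∈ upTo n ] ∑ (upTo n) (T₁ p))
             (∑-+ (upTo n) (λ p → ∑ (upTo n) (T₂ p)) (λ p → ∑ (upTo n) (T₃ p)))) ⟩
    (∑[ p ∈ upTo n ] ∑ (upTo n) (T₁ p)) + ((∑[ p ∈ upTo n ] ∑ (upTo n) (T₂ p)) + (∑[ p ∈ upTo n ] ∑ (upTo n) (T₃ p)))
      ≡⟨ cong₂ _+_ ∑T₁ (cong₂ _+_ ∑T₂ ∑-crossing²) ⟩
    (+ 2 * d + + 1) * e + (d + + n)
      ≡⟨ collect d e (+ n) ⟩
    + n + d + e + + 2 * d * e ∎
    where
    d e : ℤ
    d = ∑ (upTo n) (desAt f)
    e = ∑ (upTo n) (desAt g)
    T₁ T₂ T₃ : ℕ → ℕ → ℤ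
    T₁ p q = (∑[ s ∈ signs ] stay f p (s ◃ suc q)) * desAt g q
    T₂ p q = desAt f p * (∑[ s ∈ signs ] crossing g q (s ◃ suc p))
    T₃ p q = ∑[ s ∈ signs ] crossing f p (s ◃ suc q) * crossing g q (s ◃ suc p)
    collect : ∀ d e n → (+ 2 * d + + 1) * e + (d + n) ≡ n + d + e + + 2 * d * e
    collect = solve-∀
    expand : ∀ d c c′ e k k′ →
      (d + c) * (e + k) + ((d + c′) * (e + k′) + + 0)
        ≡ ((d + c) + ((d + c′) + + 0)) * e + (d * (k + (k′ + + 0)) + (c * k + (c′ * k′ + + 0)))
    expand = solve-∀
    split : ∀ p q → (∑[ s ∈ signs ] stay f p (s ◃ suc q) * stay g q (s ◃ suc p)) ≡ T₁ p q + (T₂ p q + T₃ p q)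
    split p q = expand (desAt f p) (crossing f p (+ suc q)) (crossing f p -[1+ q ])
                       (desAt g q) (crossing g q (+ suc p)) (crossing g q -[1+ p ])
    ∑T₁ : (∑[ p ∈ upTo n ] ∑ (upTo n) (T₁ p)) ≡ (+ 2 * d + + 1) * e
    ∑T₁ = begin
      (∑[ p ∈ upTo n ] ∑[ q ∈ upTo n ] T₁ p q)
        ≡⟨ ∑-swap (upTo n) (upTo n) T₁ ⟩
      (∑[ q ∈ upTo n ] ∑[ p ∈ upTo n ] T₁ p q)
        ≡⟨ ∑-cong-< n (λ q q<n → trans (∑-*ʳ (upTo n) (λ p → ∑[ s ∈ signs ] stay f p (s ◃ suc q)) (desAt g q))
             (cong (λ z → z * desAt g q) (∑-stay f f0≡0 fn≡n q<n))) ⟩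
      (∑[ q ∈ upTo n ] (+ 2 * d + + 1) * desAt g q)
        ≡⟨ ∑-*ˡ (upTo n) (+ 2 * d + + 1) (desAt g) ⟩
      (+ 2 * d + + 1) * e ∎
    ∑T₂ : (∑[ p ∈ upTo n ] ∑ (upTo n) (T₂ p)) ≡ d
    ∑T₂ = ∑-cong-< n (λ p p<n → begin
      (∑[ q ∈ upTo n ] desAt f p * (∑[ s ∈ signs ] crossing g q (s ◃ suc p)))
        ≡⟨ ∑-*ˡ (upTo n) (desAt f p) (λ q → ∑[ s ∈ signs ] crossing g q (s ◃ suc p)) ⟩
      desAt f p * (∑[ q ∈ upTo n ] ∑[ s ∈ signs ] crossing g q (s ◃ suc p))
        ≡⟨ cong (λ z → desAt f p * z) (trans (∑-swap (upTo n) signs (λ q s → crossing g q (s ◃ suc p)))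
             (∑-signs-crossing g g0≡0 gn≡n p<n)) ⟩
      desAt f p * + 1
        ≡⟨ ℤ.*-identityʳ _ ⟩
      desAt f p ∎)

-- Counting words and signed permutations

∑-insert : ∀ p (v : A) xs f → ∑ (insert p v xs) f ≡ f v + ∑ xs f
∑-insert zero    v xs       f = refl
∑-insert (suc p) v []       f = refl
∑-insert (suc p) v (x ∷ xs) f = trans (+-congʳ (f x) (∑-insert p v xs f)) (left-comm (f x) (f v) _)
  where
  left-comm : ∀ a b c → a + (b + c) ≡ b + (a + c)
  left-comm = solve-∀

∑-upTo-punch : ∀ {q n} → q ≤ n → ∀ f → ∑ (upTo (suc n)) f ≡ f q + ∑ (upTo n) (f ∘ punch q)
∑-upTo-punch {q} {n} q≤n f = begin
  ∑ (upTo (suc n)) f                        ≡⟨ cong (λ ks → ∑ ks f) (applyUpTo-insert id q≤n) ⟩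
  ∑ (insert q q (applyUpTo (punch q) n)) f  ≡⟨ ∑-insert q q (applyUpTo (punch q) n) f ⟩
  f q + ∑ (applyUpTo (punch q) n) f         ≡⟨ +-congʳ (f q) (∑-applyUpTo (punch q) n f) ⟩
  f q + ∑ (upTo n) (f ∘ punch q)            ∎

∑-letters : ∀ n h → ∑ (letters n) h ≡ (∑[ q ∈ upTo n ] ∑[ s ∈ signs ] h (s ◃ suc q))
∑-letters n h = trans (∑-concatMap (λ k → (+ k) ∷ (ℤ.- (+ k)) ∷ []) (oneTo n) h)
                      (∑-map suc (upTo n) (λ k → ∑ ((+ k) ∷ (ℤ.- (+ k)) ∷ []) h))

-- The letters other than ±(q + 1) are exactly the bumped letters of the smaller alphabet.
∑-letters-bump : ∀ {q n} → q ≤ n → ∀ h → (∀ s → h (s ◃ suc q) ≡ + 0) →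
  ∑ (letters (suc n)) h ≡ ∑ (letters n) (h ∘ bump q)
∑-letters-bump {q} {n} q≤n h h≡0 = begin
  ∑ (letters (suc n)) h
    ≡⟨ ∑-letters (suc n) h ⟩
  (∑[ k ∈ upTo (suc n) ] ∑[ s ∈ signs ] h (s ◃ suc k))
    ≡⟨ ∑-upTo-punch q≤n (λ k → ∑[ s ∈ signs ] h (s ◃ suc k)) ⟩
  (∑[ s ∈ signs ] h (s ◃ suc q)) + (∑[ k ∈ upTo n ] ∑[ s ∈ signs ] h (s ◃ suc (punch q k)))
    ≡⟨ cong₂ _+_ (∑-cong signs h≡0)
         (∑-cong (upTo n) (λ k → ∑-cong signs (λ s → cong h (sym (bump-◃ q s k))))) ⟩
  + 0 + (∑[ k ∈ upTo n ] ∑[ s ∈ signs ] h (bump q (s ◃ suc k)))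
    ≡⟨ ℤ.+-identityˡ _ ⟩
  (∑[ k ∈ upTo n ] ∑[ s ∈ signs ] h (bump q (s ◃ suc k)))
    ≡⟨ ∑-letters n (h ∘ bump q) ⟨
  ∑ (letters n) (h ∘ bump q) ∎

words-length : ∀ n m → All (λ w → length w ≡ m) (words n m)
words-length n zero    = refl ∷ []
words-length n (suc m) = All.concat⁺ (All.map⁺
  (All.map (λ len → All.map⁺ (All.universal (λ _ → cong suc len) (letters n))) (words-length n m)))

∑-words-suc : ∀ n m f → ∑ (words n (suc m)) f ≡ (∑[ x ∈ letters n ] ∑[ w ∈ words n m ] f (x ∷ w))
∑-words-suc n m f = begin
  ∑ (words n (suc m)) f
    ≡⟨ ∑-concatMap (λ w → map (_∷ w) (letters n)) (words n m) f ⟩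
  (∑[ w ∈ words n m ] ∑ (map (_∷ w) (letters n)) f)
    ≡⟨ ∑-cong (words n m) (λ w → ∑-map (_∷ w) (letters n) f) ⟩
  (∑[ w ∈ words n m ] ∑[ x ∈ letters n ] f (x ∷ w))
    ≡⟨ ∑-swap (words n m) (letters n) (λ w x → f (x ∷ w)) ⟩
  (∑[ x ∈ letters n ] ∑[ w ∈ words n m ] f (x ∷ w)) ∎

∑-words-insert : ∀ n {p m} → p ≤ m → ∀ f →
  ∑ (words n (suc m)) f ≡ (∑[ v ∈ letters n ] ∑[ w ∈ words n m ] f (insert p v w))
∑-words-insert n {m = m} z≤n f = ∑-words-suc n m f
∑-words-insert n {suc p} {suc m} (s≤s p≤m) f = begin
  ∑ (words n (suc (suc m))) f
    ≡⟨ ∑-words-suc n (suc m) f ⟩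
  (∑[ x ∈ letters n ] ∑[ w ∈ words n (suc m) ] f (x ∷ w))
    ≡⟨ ∑-cong (letters n) (λ x → ∑-words-insert n p≤m (λ w → f (x ∷ w))) ⟩
  (∑[ x ∈ letters n ] ∑[ v ∈ letters n ] ∑[ w ∈ words n m ] f (x ∷ insert p v w))
    ≡⟨ ∑-swap (letters n) (letters n) (λ x v → ∑[ w ∈ words n m ] f (x ∷ insert p v w)) ⟩
  (∑[ v ∈ letters n ] ∑[ x ∈ letters n ] ∑[ w ∈ words n m ] f (x ∷ insert p v w))
    ≡⟨ ∑-cong (letters n) (λ v → ∑-words-suc n m (f ∘ insert (suc p) v)) ⟨
  (∑[ v ∈ letters n ] ∑[ w ∈ words n (suc m) ] f (insert (suc p) v w)) ∎

-- Applies `∑-letters-bump` to one letter after another. The vanishing hypothesis speaks of words of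
-- length m because `¬insert-repeated`, which supplies it, rests on a count of letters.
∑-words-bump : ∀ {q n} → q ≤ n → ∀ m f →
  (∀ {w} → length w ≡ m → Any (λ x → ∣ x ∣ ≡ suc q) w → f w ≡ + 0) →
  ∑ (words (suc n) m) f ≡ ∑ (words n m) (f ∘ map (bump q))
∑-words-bump q≤n zero    f f≡0 = refl
∑-words-bump {q} {n} q≤n (suc m) f f≡0 = begin
  ∑ (words (suc n) (suc m)) f
    ≡⟨ ∑-words-suc (suc n) m f ⟩
  (∑[ x ∈ letters (suc n) ] ∑[ w ∈ words (suc n) m ] f (x ∷ w))
    ≡⟨ ∑-letters-bump q≤n (λ x → ∑[ w ∈ words (suc n) m ] f (x ∷ w))
         (λ s → trans (∑-cong-All (All.map (λ len → f≡0 (cong suc len) (here (∣◃∣ s q))) (words-length (suc n) m)))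
           (∑-zero (words (suc n) m))) ⟩
  (∑[ x ∈ letters n ] ∑[ w ∈ words (suc n) m ] f (bump q x ∷ w))
    ≡⟨ ∑-cong (letters n) (λ x → ∑-words-bump q≤n m (λ w → f (bump q x ∷ w))
         (λ len any → f≡0 (cong suc len) (there any))) ⟩
  (∑[ x ∈ letters n ] ∑[ w ∈ words n m ] f (bump q x ∷ map (bump q) w))
    ≡⟨ ∑-words-suc n m (f ∘ map (bump q)) ⟨
  ∑ (words n (suc m)) (f ∘ map (bump q)) ∎

insertBumped : ℕ → Sign → ℕ → List ℤ → List ℤ
insertBumped p s q σ = insert p (s ◃ suc q) (map (bump q) σ)

-- For a fixed slot p the letter found there determines q and s, and lowering the absolute values
-- above q determines σ. Instead of a bijection between filtered lists, sums over all words weighted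
-- by the indicator of `isSignedPerm` are compared.
∑-signedPerms-insert : ∀ {p m} → p ≤ m → ∀ f →
  ∑ (signedPerms (suc m)) f
    ≡ (∑[ q ∈ upTo (suc m) ] ∑[ s ∈ signs ] ∑[ σ ∈ signedPerms m ] f (insertBumped p s q σ))
∑-signedPerms-insert {p} {m} p≤m f = begin
  ∑ (signedPerms n) f
    ≡⟨ ∑-filter (isSignedPerm? n) (words n n) f ⟩
  ∑ (words n n) χf
    ≡⟨ ∑-words-insert n p≤m χf ⟩
  (∑[ v ∈ letters n ] ∑[ w ∈ words n m ] χf (insert p v w))
    ≡⟨ ∑-letters n (λ v → ∑[ w ∈ words n m ] χf (insert p v w)) ⟩
  (∑[ q ∈ upTo n ] ∑[ s ∈ signs ] ∑[ w ∈ words n m ] χf (insert p (s ◃ suc q) w))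
    ≡⟨ ∑-cong-< n (λ { q (s≤s q≤m) → ∑-cong signs (λ s → slot s q q≤m) }) ⟩
  (∑[ q ∈ upTo n ] ∑[ s ∈ signs ] ∑[ σ ∈ signedPerms m ] f (insertBumped p s q σ)) ∎
  where
  n : ℕ
  n = suc m
  χf : List ℤ → ℤ
  χf π = ⟦ does (isSignedPerm? n π) ⟧ * f π
  slot : ∀ s q → q ≤ m →
    (∑[ w ∈ words n m ] χf (insert p (s ◃ suc q) w)) ≡ (∑[ σ ∈ signedPerms m ] f (insertBumped p s q σ))
  slot s q q≤m = begin
    (∑[ w ∈ words n m ] χf (insert p (s ◃ suc q) w))
      ≡⟨ ∑-words-bump q≤m m (χf ∘ insert p (s ◃ suc q)) (λ {w} len any →
           cong (λ b → ⟦ b ⟧ * f (insert p (s ◃ suc q) w))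
             (dec-false (isSignedPerm? n (insert p (s ◃ suc q) w)) (¬insert-repeated s p (cong suc len) any))) ⟩
    (∑[ σ ∈ words m m ] χf (insertBumped p s q σ))
      ≡⟨ ∑-cong (words m m) (λ σ → cong (λ b → ⟦ b ⟧ * f (insertBumped p s q σ))
           (does-⇔ (mk⇔ (insert-isSignedPerm⁻ s p σ) (insert-isSignedPerm⁺ s p σ q≤m))
             (isSignedPerm? n (insertBumped p s q σ)) (isSignedPerm? m σ))) ⟩
    (∑[ σ ∈ words m m ] ⟦ does (isSignedPerm? m σ) ⟧ * f (insertBumped p s q σ))
      ≡⟨ ∑-filter (isSignedPerm? m) (words m m) (f ∘ insertBumped p s q) ⟨
    (∑[ σ ∈ signedPerms m ] f (insertBumped p s q σ)) ∎

signedPerms-valid : ∀ m → All (λ σ → length σ ≡ m × isSignedPerm m σ) (signedPerms m)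
signedPerms-valid m = All.zip
  ( All.filter⁺ (isSignedPerm? m) (words-length m m)
  , All.all-filter (isSignedPerm? m) (words m m) )

-- Indicators, the effects of all insertions into one permutation, and the recurrence

δ : ℤ → ℤ → ℤ
δ x y = ⟦ does (x ℤ.≟ y) ⟧

⟦∧⟧ : ∀ a b → ⟦ a ∧ b ⟧ ≡ ⟦ a ⟧ * ⟦ b ⟧
⟦∧⟧ true  b = sym (ℤ.*-identityˡ ⟦ b ⟧)
⟦∧⟧ false b = refl

bnij-∑ : ∀ n i j → + bnij n i j ≡ (∑[ π ∈ signedPerms n ] δ (+ desB π) i * δ (+ idesB n π) j)
bnij-∑ n i j = begin
  + length (filter P? (signedPerms n))
    ≡⟨ ℤ.*-identityʳ (+ length (filter P? (signedPerms n))) ⟨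
  + length (filter P? (signedPerms n)) * + 1
    ≡⟨ ∑-const (filter P? (signedPerms n)) (+ 1) ⟨
  (∑[ _ ∈ filter P? (signedPerms n) ] + 1)
    ≡⟨ ∑-filter P? (signedPerms n) (λ _ → + 1) ⟩
  (∑[ π ∈ signedPerms n ] ⟦ does (P? π) ⟧ * + 1)
    ≡⟨ ∑-cong (signedPerms n) (λ π → trans (ℤ.*-identityʳ _)
         (⟦∧⟧ (does ((+ desB π) ℤ.≟ i)) (does ((+ idesB n π) ℤ.≟ j)))) ⟩
  (∑[ π ∈ signedPerms n ] δ (+ desB π) i * δ (+ idesB n π) j) ∎
  where
  P? = λ π → (+ desB π) ℤ.≟ i ×-dec (+ idesB n π) ℤ.≟ j

-- Interpolation between the two possible values of x makes the indicator affine in x. Sums over all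
-- insertions then depend only on the sums of x, y and x y.
δ-step : ∀ {x} → x ≡ + 0 ⊎ x ≡ + 1 → ∀ d i →
  δ (d + (+ 1 - x)) i ≡ x * δ d i + (+ 1 - x) * δ d (i - + 1)
δ-step (inj₁ refl) d i = trans
  (cong ⟦_⟧ (does-⇔ (mk⇔ (λ { refl → sym (cancel d) }) (λ { refl → cancel′ i })) (d + + 1 ℤ.≟ i) (d ℤ.≟ i - + 1)))
  (sym (simplify (δ d i) (δ d (i - + 1))))
  where
  cancel : ∀ d → d + + 1 - + 1 ≡ d
  cancel = solve-∀
  cancel′ : ∀ i → i - + 1 + + 1 ≡ i
  cancel′ = solve-∀
  simplify : ∀ a b → + 0 * a + + 1 * b ≡ b
  simplify = solve-∀
δ-step (inj₂ refl) d i = trans (cong (λ z → δ z i) (ℤ.+-identityʳ d)) (sym (simplify (δ d i) (δ d (i - + 1))))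
  where
  simplify : ∀ a b → + 1 * a + + 0 * b ≡ a
  simplify = solve-∀

-- Off d = i, e = j both sides vanish. This trades coefficients in the statistics of σ for
-- coefficients in the indices, which can leave the sum over σ.
δ-subst : ∀ d i e j (C : ℤ → ℤ → ℤ) → C d e * (δ d i * δ e j) ≡ C i j * (δ d i * δ e j)
δ-subst d i e j C with d ℤ.≟ i | e ℤ.≟ j
... | yes refl | yes refl = refl
... | yes refl | no _     = trans (ℤ.*-zeroʳ (C d e)) (sym (ℤ.*-zeroʳ (C i j)))
... | no _     | _        = trans (ℤ.*-zeroʳ (C d e)) (sym (ℤ.*-zeroʳ (C i j)))

-- All 2 n n insertions in a single list, so that linearity and the exchange with the sum over σ are
-- each applied once.
cells : ℕ → List (ℕ × ℕ × Sign)
cells n = cartesianProduct (upTo n) (cartesianProduct (upTo n) signs)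

∑-cells : ∀ n (f : ℕ × ℕ × Sign → ℤ) →
  ∑ (cells n) f ≡ (∑[ p ∈ upTo n ] ∑[ q ∈ upTo n ] ∑[ s ∈ signs ] f (p , q , s))
∑-cells n f = trans (∑-cartesianProduct (upTo n) (cartesianProduct (upTo n) signs) f)
  (∑-cong (upTo n) (λ p → ∑-cartesianProduct (upTo n) signs (λ c → f (p , c))))

∑-bilinear : ∀ (xs : List A) (u v w : A → ℤ) a b c e →
  (∑[ t ∈ xs ] u t * a + (v t * b + (w t * c + e)))
    ≡ ∑ xs u * a + (∑ xs v * b + (∑ xs w * c + (∑[ _ ∈ xs ] e)))
∑-bilinear xs u v w a b c e = begin
  (∑[ t ∈ xs ] u t * a + (v t * b + (w t * c + e)))
    ≡⟨ ∑-+ xs (λ t → u t * a) (λ t → v t * b + (w t * c + e)) ⟩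
  (∑[ t ∈ xs ] u t * a) + (∑[ t ∈ xs ] v t * b + (w t * c + e))
    ≡⟨ cong₂ _+_ (∑-*ʳ xs u a) (∑-+ xs (λ t → v t * b) (λ t → w t * c + e)) ⟩
  ∑ xs u * a + ((∑[ t ∈ xs ] v t * b) + (∑[ t ∈ xs ] w t * c + e))
    ≡⟨ +-congʳ (∑ xs u * a) (cong₂ _+_ (∑-*ʳ xs v b)
         (trans (∑-+ xs (λ t → w t * c) (λ _ → e)) (cong (λ z → z + (∑[ _ ∈ xs ] e)) (∑-*ʳ xs w c)))) ⟩
  ∑ xs u * a + (∑ xs v * b + (∑ xs w * c + (∑[ _ ∈ xs ] e))) ∎

-- The numbers of insertions into a σ with `desB` equal to i and `idesB` equal to j: a first
-- subscript 1 means that `desB` rises, a second that `idesB` rises. They are the sums of X Y, X (1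
-- - Y), (1 - X) Y and (1 - X) (1 - Y).
c₀₀ c₀₁ c₁₀ c₁₁ : ℤ → ℤ → ℤ → ℤ
c₀₀ n i j = n + i + j + + 2 * i * j
c₀₁ n i j = (+ 2 * n - + 1) * i - (+ 2 * i + + 1) * j
c₁₀ n i j = (+ 2 * n - + 1) * j - (+ 2 * j + + 1) * i
c₁₁ n i j = (+ 2 * n * n - n) + + 2 * i * j + (+ 1 - + 2 * n) * (i + j)

c₁₁-shifted : ∀ n i j → c₁₁ n (i - + 1) (j - + 1)
  ≡ (+ 2 * n * n - n) + + 2 * (i - + 1) * (j - + 1) + (+ 1 - + 2 * n) * (i + j - + 2)
c₁₁-shifted n i j =
  cong (λ z → (+ 2 * n * n - n) + + 2 * (i - + 1) * (j - + 1) + (+ 1 - + 2 * n) * z) (regroup i j)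
  where
  regroup : ∀ i j → (i - + 1) + (j - + 1) ≡ i + j - + 2
  regroup = solve-∀

gtR-bounded : ∀ x {n} → ∣ x ∣ ≤ n → gtR x (+ n) ≡ false
gtR-bounded (+ a)    a≤n = ⌊<?⌋-false a≤n
gtR-bounded -[1+ a ] _   = refl

∣invAux∣ : ∀ k i xs → ∣ invAux k (suc i) xs ∣ ≤ i ℕ.+ length xs
∣invAux∣ k i []       = z≤n
∣invAux∣ k i (x ∷ xs) with ∣ x ∣ ℕ.≟ k
... | yes _ rewrite signed-index x i | ∣◃∣ (sign x) i | ℕ.+-suc i (length xs) = s≤s (ℕ.m≤m+n i (length xs))
... | no _  rewrite ℕ.+-suc i (length xs) = ∣invAux∣ k (suc i) xs

module _ (σ : List ℤ) (σ-perm : isSignedPerm (length σ) σ) where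

  private
    m n : ℕ
    m = length σ
    n = suc m
    τ : List ℤ
    τ = inverse m σ
    -- The index n lies just past the end of `+ 0 ∷ σ`, so the default `+ n` becomes the extra last
    -- letter.
    f g : ℕ → ℤ
    f = nth (+ n) (+ 0 ∷ σ)
    g = nth (+ n) (+ 0 ∷ τ)
    d e : ℤ
    d = + desB σ
    e = + idesB m σ
    x y : ℕ × ℕ × Sign → ℤ
    x (p , q , s) = stay f p (s ◃ suc q)
    y (p , q , s) = stay g q (s ◃ suc p)

    length-τ : length τ ≡ m
    length-τ = trans (cong length (inverse≡applyUpTo m σ)) (length-applyUpTo _ m)

    σ-bounded : All (λ x → ∣ x ∣ ≤ m) σ
    σ-bounded = All.tabulate (λ {x} x∈σ → bound {x} (abs-range refl σ-perm x∈σ))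
      where
      bound : ∀ {x} → (∃ λ k → k < m × ∣ x ∣ ≡ suc k) → ∣ x ∣ ≤ m
      bound (k , k<m , eq) = subst (_≤ m) (sym eq) k<m

    σ≯n : All (λ x → gtR x (+ n) ≡ false) (+ 0 ∷ σ)
    σ≯n = refl ∷ All.map (λ {x} b → gtR-bounded x (ℕ.m≤n⇒m≤1+n b)) σ-bounded

    τ≯n : All (λ x → gtR x (+ n) ≡ false) (+ 0 ∷ τ)
    τ≯n = refl ∷ subst (All (λ x → gtR x (+ n) ≡ false)) (sym (inverse≡applyUpTo m σ))
      (All.applyUpTo⁺₂ (λ k → invAux (suc k) 1 σ) m
        (λ k → gtR-bounded (invAux (suc k) 1 σ) (ℕ.m≤n⇒m≤1+n (∣invAux∣ (suc k) 0 σ))))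

    fn≡n : f n ≡ + n
    fn≡n = nth-length (+ n) σ

    gn≡n : g n ≡ + n
    gn≡n = trans (cong (nth (+ n) τ) (sym length-τ)) (nth-length (+ n) τ)

    ∑-desAt-f : ∑ (upTo n) (desAt f) ≡ d
    ∑-desAt-f = descentsFrom-∑ (+ n) (+ 0) σ σ≯n

    ∑-desAt-g : ∑ (upTo n) (desAt g) ≡ e
    ∑-desAt-g = trans (cong (λ l → ∑ (upTo (suc l)) (desAt g)) (sym length-τ)) (descentsFrom-∑ (+ n) (+ 0) τ τ≯n)

    f-bound : ∀ {p} → p ≤ n → ∣ f p ∣ ≤ n
    f-bound {zero}  _ = z≤n
    f-bound {suc p} (s≤s p≤m) with ℕ.m≤n⇒m<n∨m≡n p≤m
    ... | inj₁ p<m  = ℕ.m≤n⇒m≤1+n (All.lookup σ-bounded (nth-∈ (+ n) σ p<m))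
    ... | inj₂ refl rewrite nth-length (+ n) σ = ℕ.≤-refl

    -- Up to sign g undoes f, and this holds at the added ends 0 and n as well. In between it is the
    -- definition of the inverse, read at the absolute value of a letter.
    g-inverse : ∀ {p} → p ≤ n → g ∣ f p ∣ ≡ sign (f p) ◃ p
    g-inverse {zero}  _ = refl
    g-inverse {suc p} (s≤s p≤m) with ℕ.m≤n⇒m<n∨m≡n p≤m
    ... | inj₂ refl rewrite nth-length (+ n) σ = gn≡n
    ... | inj₁ p<m with k , k<m , eq ← abs-range refl σ-perm (nth-∈ (+ n) σ p<m) = begin
      g ∣ nth (+ n) σ p ∣
        ≡⟨ cong g eq ⟩
      nth (+ n) τ k
        ≡⟨ cong (λ ys → nth (+ n) ys k) (inverse≡applyUpTo m σ) ⟩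
      nth (+ n) (applyUpTo (λ k → invAux (suc k) 1 σ) m) k
        ≡⟨ nth-applyUpTo (+ n) (λ k → invAux (suc k) 1 σ) k<m ⟩
      invAux (suc k) 1 σ
        ≡⟨ cong (λ l → invAux l 1 σ) eq ⟨
      invAux ∣ nth (+ n) σ p ∣ 1 σ
        ≡⟨ invAux-nth (+ n) 0 σ (abs-unique refl σ-perm) p<m ⟩
      sign (nth (+ n) σ p) ◃ suc p ∎

    ∑x : ∑ (cells n) x ≡ + n * (+ 2 * d + + 1)
    ∑x = trans (∑-cells n x) (trans (∑-stay-all f refl fn≡n) (cong (λ d → + n * (+ 2 * d + + 1)) ∑-desAt-f))

    ∑y : ∑ (cells n) y ≡ + n * (+ 2 * e + + 1)
    -- Exchanging the sums over p and q turns this into `∑-stay-all` for g.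
    ∑y = trans (∑-cells n y) (trans (∑-swap (upTo n) (upTo n) (λ p q → ∑[ s ∈ signs ] stay g q (s ◃ suc p)))
      (trans (∑-stay-all g refl gn≡n) (cong (λ d → + n * (+ 2 * d + + 1)) ∑-desAt-g)))

    ∑xy : (∑[ c ∈ cells n ] x c * y c) ≡ + n + d + e + + 2 * d * e
    ∑xy = trans (∑-cells n (λ c → x c * y c))
      (trans (∑-stay² f g refl fn≡n refl gn≡n f-bound g-inverse)
        (cong₂ (λ d e → + n + d + e + + 2 * d * e) ∑-desAt-f ∑-desAt-g))

    ∑-const-cells : ∀ c → (∑[ _ ∈ cells n ] c) ≡ + n * (+ n * (+ 2 * c))
    ∑-const-cells c = trans (∑-cells n (λ _ → c)) (trans
      (∑-cong (upTo n) (λ _ → trans (∑-cong (upTo n) (λ _ → ∑-const signs c)) (∑-upTo-const n (+ 2 * c))))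
      (∑-upTo-const n (+ n * (+ 2 * c))))

    -- `bump q` fixes 0 by computation, so the initial `+ 0` of `desB` serves as the first letter in
    -- `descentsFrom-insert`.
    desB-insert : ∀ p q s → p ≤ m → q ≤ m → + desB (insertBumped p s q σ) ≡ d + (+ 1 - x (p , q , s))
    desB-insert p q s p≤m q≤m = descentsFrom-insert (+ n) s q (+ 0) σ p≤m σ≯n (gtR-top s (s≤s q≤m))

    idesB-insert : ∀ p q s → p ≤ m → q ≤ m → + idesB n (insertBumped p s q σ) ≡ e + (+ 1 - y (p , q , s))
    idesB-insert p q s p≤m q≤m = trans (cong (λ π → + desB π) (inverse-insert s σ p≤m q≤m))
      (descentsFrom-insert (+ n) s p (+ 0) τ (subst (q ≤_) (sym length-τ) q≤m) τ≯n (gtR-top s (s≤s p≤m)))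

  ∑-insertions : ∀ i j →
    (∑[ p ∈ upTo n ] ∑[ q ∈ upTo n ] ∑[ s ∈ signs ]
        δ (+ desB (insertBumped p s q σ)) i * δ (+ idesB n (insertBumped p s q σ)) j)
      ≡ c₀₀ (+ n) i j * (δ d i * δ e j)
        + c₀₁ (+ n) i (j - + 1) * (δ d i * δ e (j - + 1))
        + c₁₀ (+ n) (i - + 1) j * (δ d (i - + 1) * δ e j)
        + c₁₁ (+ n) (i - + 1) (j - + 1) * (δ d (i - + 1) * δ e (j - + 1))
  ∑-insertions i j = begin
    (∑[ p ∈ upTo n ] ∑[ q ∈ upTo n ] ∑[ s ∈ signs ]
        δ (+ desB (insertBumped p s q σ)) i * δ (+ idesB n (insertBumped p s q σ)) j)
      ≡⟨ ∑-cong-< n (λ { p (s≤s p≤m) → ∑-cong-< n (λ { q (s≤s q≤m) → ∑-cong signs (λ s → cell p q s p≤m q≤m) }) }) ⟩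
    (∑[ p ∈ upTo n ] ∑[ q ∈ upTo n ] ∑[ s ∈ signs ] bilinear (p , q , s))
      ≡⟨ ∑-cells n bilinear ⟨
    ∑ (cells n) bilinear
      ≡⟨ ∑-bilinear (cells n) (λ c → x c * y c) x y ((a - a′) * (b - b′)) ((a - a′) * b′) (a′ * (b - b′)) (a′ * b′) ⟩
    (∑[ c ∈ cells n ] x c * y c) * ((a - a′) * (b - b′))
      + (∑ (cells n) x * ((a - a′) * b′) + (∑ (cells n) y * (a′ * (b - b′)) + (∑[ _ ∈ cells n ] a′ * b′)))
      ≡⟨ cong₂ _+_ (cong (λ z → z * ((a - a′) * (b - b′))) ∑xy)
           (cong₂ _+_ (cong (λ z → z * ((a - a′) * b′)) ∑x)
             (cong₂ _+_ (cong (λ z → z * (a′ * (b - b′))) ∑y) (∑-const-cells (a′ * b′)))) ⟩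
    (+ n + d + e + + 2 * d * e) * ((a - a′) * (b - b′))
      + (+ n * (+ 2 * d + + 1) * ((a - a′) * b′)
        + (+ n * (+ 2 * e + + 1) * (a′ * (b - b′)) + + n * (+ n * (+ 2 * (a′ * b′)))))
      -- Regrouping by the four products of indicators shows the coefficients as the insertion
      -- counts at (d, e).
      ≡⟨ collect (+ n) d e a a′ b b′ ⟩
    c₀₀ (+ n) d e * (a * b) + c₀₁ (+ n) d e * (a * b′) + c₁₀ (+ n) d e * (a′ * b) + c₁₁ (+ n) d e * (a′ * b′)
      ≡⟨ cong₂ _+_ (cong₂ _+_ (cong₂ _+_ (δ-subst d i e j (c₀₀ (+ n)))
           (δ-subst d i e (j - + 1) (c₀₁ (+ n)))) (δ-subst d (i - + 1) e j (c₁₀ (+ n))))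
           (δ-subst d (i - + 1) e (j - + 1) (c₁₁ (+ n))) ⟩
    c₀₀ (+ n) i j * (a * b)
      + c₀₁ (+ n) i (j - + 1) * (a * b′)
      + c₁₀ (+ n) (i - + 1) j * (a′ * b)
      + c₁₁ (+ n) (i - + 1) (j - + 1) * (a′ * b′) ∎
    where
    a a′ b b′ : ℤ
    a  = δ d i
    a′ = δ d (i - + 1)
    b  = δ e j
    b′ = δ e (j - + 1)
    bilinear : ℕ × ℕ × Sign → ℤ
    bilinear c = (x c * y c) * ((a - a′) * (b - b′)) + (x c * ((a - a′) * b′) + (y c * (a′ * (b - b′)) + a′ * b′))
    expand : ∀ x y a a′ b b′ → (x * a + (+ 1 - x) * a′) * (y * b + (+ 1 - y) * b′)
      ≡ (x * y) * ((a - a′) * (b - b′)) + (x * ((a - a′) * b′) + (y * (a′ * (b - b′)) + a′ * b′))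
    expand = solve-∀
    collect : ∀ n d e a a′ b b′ →
      (n + d + e + + 2 * d * e) * ((a - a′) * (b - b′))
        + (n * (+ 2 * d + + 1) * ((a - a′) * b′)
          + (n * (+ 2 * e + + 1) * (a′ * (b - b′)) + n * (n * (+ 2 * (a′ * b′)))))
      ≡ (n + d + e + + 2 * d * e) * (a * b)
        + ((+ 2 * n - + 1) * d - (+ 2 * d + + 1) * e) * (a * b′)
        + ((+ 2 * n - + 1) * e - (+ 2 * e + + 1) * d) * (a′ * b)
        + ((+ 2 * n * n - n) + + 2 * d * e + (+ 1 - + 2 * n) * (d + e)) * (a′ * b′)
    collect = solve-∀
    cell : ∀ p q s → p ≤ m → q ≤ m →
      δ (+ desB (insertBumped p s q σ)) i * δ (+ idesB n (insertBumped p s q σ)) j ≡ bilinear (p , q , s)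
    cell p q s p≤m q≤m = begin
      δ (+ desB (insertBumped p s q σ)) i * δ (+ idesB n (insertBumped p s q σ)) j
        ≡⟨ cong₂ (λ z w → δ z i * δ w j) (desB-insert p q s p≤m q≤m) (idesB-insert p q s p≤m q≤m) ⟩
      δ (d + (+ 1 - x c)) i * δ (e + (+ 1 - y c)) j
        ≡⟨ cong₂ _*_ (δ-step (stay-0-1 f p s q) d i) (δ-step (stay-0-1 g q s p) e j) ⟩
      (x c * a + (+ 1 - x c) * a′) * (y c * b + (+ 1 - y c) * b′)
        ≡⟨ expand (x c) (y c) a a′ b b′ ⟩
      bilinear c ∎
      where
      c : ℕ × ℕ × Sign
      c = p , q , s

-- The left side counts pairs of a π with the given statistics and a slot p. Removing the letter in
-- that slot sorts the pairs by the remaining σ, and `∑-insertions` evaluates each class.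
recurrence : ∀ m i j →
  + suc m * + bnij (suc m) i j
    ≡ c₀₀ (+ suc m) i j * + bnij m i j
      + c₀₁ (+ suc m) i (j - + 1) * + bnij m i (j - + 1)
      + c₁₀ (+ suc m) (i - + 1) j * + bnij m (i - + 1) j
      + c₁₁ (+ suc m) (i - + 1) (j - + 1) * + bnij m (i - + 1) (j - + 1)
recurrence m i j = begin
  + n * + bnij n i j
    ≡⟨ cong (λ z → + n * z) (bnij-∑ n i j) ⟩
  + n * ∑ (signedPerms n) F
    ≡⟨ ∑-upTo-const n (∑ (signedPerms n) F) ⟨
  (∑[ p ∈ upTo n ] ∑ (signedPerms n) F)
    -- Each of the n equal summands is expanded differently, around its own slot p.
    ≡⟨ ∑-cong-< n (λ { p (s≤s p≤m) → ∑-signedPerms-insert p≤m F }) ⟩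
  (∑[ p ∈ upTo n ] ∑[ q ∈ upTo n ] ∑[ s ∈ signs ] ∑[ σ ∈ signedPerms m ] F (insertBumped p s q σ))
    ≡⟨ ∑-cells n (λ { (p , q , s) → ∑[ σ ∈ signedPerms m ] F (insertBumped p s q σ) }) ⟨
  ∑ (cells n) (λ { (p , q , s) → ∑[ σ ∈ signedPerms m ] F (insertBumped p s q σ) })
    ≡⟨ ∑-swap (cells n) (signedPerms m) (λ { (p , q , s) σ → F (insertBumped p s q σ) }) ⟩
  (∑[ σ ∈ signedPerms m ] ∑ (cells n) (λ { (p , q , s) → F (insertBumped p s q σ) }))
    ≡⟨ ∑-cong-All (All.map per-σ (signedPerms-valid m)) ⟩
  (∑[ σ ∈ signedPerms m ] C₀₀ * G i j σ + C₀₁ * G i (j - + 1) σ + C₁₀ * G (i - + 1) j σ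
                          + C₁₁ * G (i - + 1) (j - + 1) σ)
    ≡⟨ linear (signedPerms m) (G i j) (G i (j - + 1)) (G (i - + 1) j) (G (i - + 1) (j - + 1)) ⟩
  C₀₀ * ∑ (signedPerms m) (G i j) + C₀₁ * ∑ (signedPerms m) (G i (j - + 1))
    + C₁₀ * ∑ (signedPerms m) (G (i - + 1) j) + C₁₁ * ∑ (signedPerms m) (G (i - + 1) (j - + 1))
    ≡⟨ cong₂ _+_ (cong₂ _+_ (cong₂ _+_ (count C₀₀ i j) (count C₀₁ i (j - + 1)))
         (count C₁₀ (i - + 1) j)) (count C₁₁ (i - + 1) (j - + 1)) ⟩
  C₀₀ * + bnij m i j + C₀₁ * + bnij m i (j - + 1)
    + C₁₀ * + bnij m (i - + 1) j + C₁₁ * + bnij m (i - + 1) (j - + 1) ∎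
  where
  n : ℕ
  n = suc m
  C₀₀ C₀₁ C₁₀ C₁₁ : ℤ
  C₀₀ = c₀₀ (+ n) i j
  C₀₁ = c₀₁ (+ n) i (j - + 1)
  C₁₀ = c₁₀ (+ n) (i - + 1) j
  C₁₁ = c₁₁ (+ n) (i - + 1) (j - + 1)
  F : List ℤ → ℤ
  F π = δ (+ desB π) i * δ (+ idesB n π) j
  G : ℤ → ℤ → List ℤ → ℤ
  G i j σ = δ (+ desB σ) i * δ (+ idesB m σ) j
  per-σ : ∀ {σ} → length σ ≡ m × isSignedPerm m σ →
    ∑ (cells n) (λ { (p , q , s) → F (insertBumped p s q σ) })
      ≡ C₀₀ * G i j σ + C₀₁ * G i (j - + 1) σ + C₁₀ * G (i - + 1) j σ + C₁₁ * G (i - + 1) (j - + 1) σ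
  per-σ {σ} (refl , σ-perm) =
    trans (∑-cells n (λ { (p , q , s) → F (insertBumped p s q σ) })) (∑-insertions σ σ-perm i j)
  linear : ∀ (xs : List A) f₁ f₂ f₃ f₄ →
    (∑[ t ∈ xs ] C₀₀ * f₁ t + C₀₁ * f₂ t + C₁₀ * f₃ t + C₁₁ * f₄ t)
      ≡ C₀₀ * ∑ xs f₁ + C₀₁ * ∑ xs f₂ + C₁₀ * ∑ xs f₃ + C₁₁ * ∑ xs f₄
  linear xs f₁ f₂ f₃ f₄ =
    trans (∑-+ xs (λ t → C₀₀ * f₁ t + C₀₁ * f₂ t + C₁₀ * f₃ t) (λ t → C₁₁ * f₄ t)) (cong₂ _+_
      (trans (∑-+ xs (λ t → C₀₀ * f₁ t + C₀₁ * f₂ t) (λ t → C₁₀ * f₃ t)) (cong₂ _+_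
        (trans (∑-+ xs (λ t → C₀₀ * f₁ t) (λ t → C₀₁ * f₂ t)) (cong₂ _+_ (∑-*ˡ xs C₀₀ f₁) (∑-*ˡ xs C₀₁ f₂)))
        (∑-*ˡ xs C₁₀ f₃)))
      (∑-*ˡ xs C₁₁ f₄))
  count : ∀ C i j → C * ∑ (signedPerms m) (G i j) ≡ C * + bnij m i j
  count C i j = cong (λ z → C * z) (sym (bnij-∑ m i j))

theorem1p3 : (bnij 1 (+ 0) (+ 0) ≡ 1) × (bnij 1 (+ 1) (+ 1) ≡ 1)
    × (bnij 1 (+ 0) (+ 1) ≡ 0) × (bnij 1 (+ 1) (+ 0) ≡ 0)
    × ((n : ℕ) → 2 ≤ n → (i j : ℤ) → + 0 ℤ.≤ i → i ℤ.≤ + n → + 0 ℤ.≤ j → j ℤ.≤ + n →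
    + n * + bnij n i j
    ≡ (+ n + i + j + + 2 * i * j) * + bnij (n ∸ 1) i j
    + ((+ 2 * + n - + 1) * i - (+ 2 * i + + 1) * (j - + 1)) * + bnij (n ∸ 1) i (j - + 1)
    + ((+ 2 * + n - + 1) * j - (+ 2 * j + + 1) * (i - + 1)) * + bnij (n ∸ 1) (i - + 1) j
    + ((+ 2 * + n * + n - + n) + + 2 * (i - + 1) * (j - + 1) + (+ 1 - + 2 * + n) * (i + j - + 2))
    * + bnij (n ∸ 1) (i - + 1) (j - + 1))
-- The values for n = 1 come from evaluating the enumeration.
theorem1p3 = refl , refl , refl , refl , λ where
  (suc m) _ i j _ _ _ _ → trans (recurrence m i j)
    -- The first three coefficients agree by definition; in the last one (i - 1) + (j - 1) must
    -- become i + j - 2.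
    (cong (λ z → c₀₀ (+ suc m) i j * + bnij m i j + c₀₁ (+ suc m) i (j - + 1) * + bnij m i (j - + 1)
                 + c₁₀ (+ suc m) (i - + 1) j * + bnij m (i - + 1) j + z * + bnij m (i - + 1) (j - + 1))
      (c₁₁-shifted (+ suc m) i j))
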